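{- Let $s,t\ge 1$ and let $K_{s,t}$ be the complete bipartite graph with parts of sizes $s$ and $t$. Then \[ p_{K_{s,t}}(x)=\sum_k\frac{k(s+t)\binom{s}{k}\binom{t}{k}}{st\binom{s+t}{s}}x^k, \] that is, for every $k$, the probability that the forest building process on $K_{s,t}$ produces a forest with exactly $k$ connected components is $\frac{k(s+t)\binom{s}{k}\binom{t}{k}}{st\binom{s+t}{s}}$.
   Context: Forest building process: let $G$ be a finite simple graph without isolated vertices, with $m$ edges. Choose an ordering $e_1,\dots,e_m$ of $E(G)$ uniformly at random among all $m!$ orderings. Start with the graph $S$ on vertex set $V(G)$ with no edges; for $j=1,\dots,m$ in turn, add $e_j$ to $S$ if and only if $e_j$ is incident to some vertex that is not incident to any $e_i$ with $i<j$. The final $S$ is a spanning forest of $G$. $P(G,k)$ denotes the probability that the final $S$ has exactly $k$ connected components, and $p_G(x)=\sum_k P(G,k)x^k$. A sum with no bounds runs over all values of the index for which the terms are nonzero. -}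

module Defs where

open import Data.Nat using (ℕ; zero; suc; _+_; _*_; _<_; _≤_; z≤n; s≤s; _!; NonZero; >-nonZero; _≟_)
open import Data.Nat.Properties using (_!≢0; m*n≢0; ≤-trans; m≤m+n)
open import Data.Nat.Combinatorics using (_C_; nCk≡nC[n∸k]; nCn≡1; nCk+nC[k+1]≡[n+1]C[k+1])
open import Data.Integer using (ℤ; +_)
open import Data.Rational using (ℚ; _/_)
open import Data.Bool using (Bool; true; false; not; _∨_; _∧_)
open import Data.Fin using (Fin; toℕ; _↑ˡ_; _↑ʳ_)
open import Data.Fin.Properties using () renaming (_≟_ to _≟ᶠ_)
open import Data.List using (List; []; _∷_; length; map; concatMap; filter; filterᵇ; allFin)
open import Data.Bool.ListAction using (any)
open import Data.Nat using (_≤?_)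
open import Data.Product using (_×_; _,_)
open import Relation.Nullary using (does)
open import Relation.Binary.PropositionalEquality using (_≡_; subst; sym)

-- Finite simple graphs: vertex set Fin n, edge set given as a list of
-- (distinct, non-loop) unordered edges, each stored as an ordered pair.

record Graph : Set where
  constructor graph
  field
    n     : ℕ
    edges : List (Fin n × Fin n)
open Graph public

insertions : {A : Set} → A → List A → List (List A)
insertions x []       = (x ∷ []) ∷ []
insertions x (y ∷ ys) = (x ∷ y ∷ ys) ∷ map (y ∷_) (insertions x ys)

orderings : {A : Set} → List A → List (List A)
orderings []       = [] ∷ []
orderings (x ∷ xs) = concatMap (insertions x) (orderings xs)

_==_ : {n : ℕ} → Fin n → Fin n → Bool
u == v = does (u ≟ᶠ v)

-- Process the ordered edges; `covered v` records whether v is incident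
-- to some previously processed edge.  Returns the edges added to S.
process : {n : ℕ} → (Fin n → Bool) → List (Fin n × Fin n) → List (Fin n × Fin n)
process covered []             = []
process covered ((u , v) ∷ es) with not (covered u) ∨ not (covered v)
... | true  = (u , v) ∷ process covered′ es
  where covered′ = λ w → covered w ∨ (w == u) ∨ (w == v)
... | false = process covered′ es
  where covered′ = λ w → covered w ∨ (w == u) ∨ (w == v)

forestOf : (G : Graph) → List (Fin (n G) × Fin (n G)) → List (Fin (n G) × Fin (n G))
forestOf G order = process (λ _ → false) order

reachWithin : {n : ℕ} → List (Fin n × Fin n) → ℕ → Fin n → Fin n → Bool
reachWithin S zero    u w = u == w
reachWithin S (suc i) u w =
  reachWithin S i u w ∨
  any (λ e → step e) S
  where
    step : _ → Bool
    step (a , b) = (reachWithin S i u a ∧ (w == b)) ∨ (reachWithin S i u b ∧ (w == a))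

connected : {n : ℕ} → List (Fin n × Fin n) → Fin n → Fin n → Bool
connected {n} S u w = reachWithin S n u w

-- Number of components = number of vertices v that are the least
-- vertex of their component.
components : (m : ℕ) → List (Fin m × Fin m) → ℕ
components m S =
  length (filterᵇ (λ v → not (any (λ u → does (suc (toℕ u) ≤? toℕ v) ∧ connected S u v) (allFin m))) (allFin m))

countOrderings : (G : Graph) → ℕ → ℕ
countOrderings G k =
  length (filter (λ σ → components (n G) (forestOf G σ) ≟ k) (orderings (edges G)))

P : Graph → ℕ → ℚ
P G k = ((+ countOrderings G k) / (length (edges G) !)) {{length (edges G) !≢0}}

K : ℕ → ℕ → Graph
K s t = graph (s + t) (concatMap (λ i → map (λ j → (i ↑ˡ t , s ↑ʳ j)) (allFin t)) (allFin s))

C-pos : ∀ n k → k ≤ n → 0 < n C k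
C-pos n zero z≤n = subst (0 <_) (sym (trans′ (nCk≡nC[n∸k] {k = 0} {n = n} z≤n) (nCn≡1 n))) (s≤s z≤n)
  where
    trans′ : {a b c : ℕ} → a ≡ b → b ≡ c → a ≡ c
    trans′ Relation.Binary.PropositionalEquality.refl q = q
C-pos (suc n) (suc k) (s≤s k≤n) =
  subst (0 <_) (nCk+nC[k+1]≡[n+1]C[k+1] n k) (≤-trans (C-pos n k k≤n) (m≤m+n (n C k) (n C suc k)))

denom : (s t : ℕ) → .{{NonZero s}} → .{{NonZero t}} → ℕ
denom s t = s * t * ((s + t) C s)

denom-nonZero : (s t : ℕ) → .{{_ : NonZero s}} → .{{_ : NonZero t}} → NonZero (denom s t)
denom-nonZero s t = m*n≢0 (s * t) ((s + t) C s) {{m*n≢0 s t}} {{>-nonZero (C-pos (s + t) s (m≤m+n s t))}}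

formula : (s t : ℕ) → .{{NonZero s}} → .{{NonZero t}} → ℕ → ℚ
formula s t k = ((+ (k * (s + t) * (s C k) * (t C k))) / denom s t) {{denom-nonZero s t}}

{-# OPTIONS --safe #-}

-- Each component of the final forest is started by exactly one edge whose two
-- ends were both uncovered when it was processed, so the number of components
-- is the number X of such edges.  Let a and b be the numbers of uncovered
-- vertices in the two parts.  Conditioning on the next edge shows that the
-- falling factorial moments of the number of starting edges still to come are
-- a^(r) b^(r) / (s+t-1)^(r), where x^(r) = x (x-1) ⋯ (x-r+1): edges with both
-- ends covered change nothing, and the others balance.  Hence X has moments
-- s^(r) t^(r) / (s+t-1)^(r).  By Vandermonde's convolution the claimed
-- distribution has the same moments, and since X ≤ s the moments of order at
-- most s determine the distribution.

module Submission where

open import Defs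
open import Data.Nat using (ℕ; NonZero)
open import Relation.Binary.PropositionalEquality using (_≡_)

import Data.Nat as ℕ
import Data.Nat.Properties as ℕ
open import Data.Bool using (Bool; true; false; not; _∨_; _∧_; if_then_else_; T; T?)
open import Data.Bool.ListAction using (any; or)
open import Data.Bool.Properties using (∨-assoc; ∨-identityʳ; ∨-zeroʳ; T-≡; T-∨; T-∧)
open import Data.Fin using (Fin; zero; suc; toℕ; fromℕ<; splitAt; join; _↑ˡ_; _↑ʳ_)
open import Data.Fin.Properties using (↑ˡ-injective; ↑ʳ-injective; splitAt-↑ˡ; splitAt-↑ʳ; join-splitAt)
  renaming (_≟_ to _≟ᶠ_)
open import Data.Integer using (ℤ; +_; _+_; _*_; _-_; 0ℤ; 1ℤ)
open import Data.Integer.Properties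
open import Data.Integer.Tactic.RingSolver using (solve-∀)
open import Data.List using (List; []; _∷_; _++_; _∷ʳ_; length; map; concatMap; filter; allFin; foldl; downFrom)
open import Data.List.Membership.Propositional using (_∈_; find; lose)
open import Data.List.Membership.Propositional.Properties
  using (∈-map⁺; ∈-map⁻; ∈-allFin; ∈-++⁺ˡ; ∈-++⁺ʳ; ∈-++⁻; ∈-concatMap⁺; ∈-concatMap⁻; ∈-downFrom⁻)
open import Data.List.Properties using (map-tabulate; map-∘; ++-assoc; ++-identityʳ; length-++; length-tabulate)
open import Data.List.Relation.Binary.Permutation.Propositional using (_↭_; ↭-refl; ↭-trans; ↭-sym; prep; swap)
open import Data.List.Relation.Binary.Permutation.Propositional.Properties using (∈-resp-↭)
open import Data.List.Relation.Unary.All as All using (All; []; _∷_)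
open import Data.List.Relation.Unary.Any using (here; there)
open import Data.List.Relation.Unary.Any.Properties using (any⁺; any⁻)
open import Data.Nat using (zero; suc; pred; _!; _≤_; _<_; z≤n; s≤s)
open import Data.Nat.Combinatorics using (_C_; nCk+nC[k+1]≡[n+1]C[k+1]; nC1≡n; k>n⇒nCk≡0)
open import Data.Product using (_×_; _,_; proj₁; proj₂; ∃₂; ∃-syntax)
open import Data.Rational using (_/_)
open import Data.Rational.Properties using (fromℚᵘ-cong)
open import Data.Rational.Unnormalised using (mkℚᵘ; *≡*)
open import Data.Sum as Sum using (_⊎_; inj₁; inj₂)
open import Function using (_∘_; id; Equivalence)
open import Relation.Binary.PropositionalEquality
  using (_≢_; refl; sym; trans; cong; cong₂; subst; module ≡-Reasoning)
open import Relation.Nullary using (Dec; does; yes; no; contradiction)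
open import Relation.Nullary.Decidable using (dec-true; dec-false)

open ≡-Reasoning

-- The moment formula has to hold in every intermediate state while its value depends on `a` and `b`
-- only, although the list of remaining edges varies. An edge with both ends covered has increment
-- zero, so the increments may be summed over all of K_{s,t} instead of the remaining edges. There
-- ab edges have two uncovered ends, a(t-b) and (s-a)b have one. Relative to a^(r) b^(r) the three
-- classes contribute r(s+t-a-b), -r(t-b) and -r(s-a), provided that the divisors of orders r and
-- r-1 have ratio s+t-r; this is what forces the divisor (s+t-1)^(r). It is nonzero for r ≤ s
-- because t ≥ 1. All identities live in ℤ, with factorials and divisors multiplied across, and
-- fractions appear only in the final comparison. On the graph side `components` is defined by a
-- bounded search, so the components are counted by way of a vertex labelling that is maintained
-- along the process.

private variable
  A B : Set
  m : ℕ

+-congˡ : ∀ a {b c} → b ≡ c → a + b ≡ a + c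
+-congˡ a = cong (λ z → a + z)

*-congˡ : ∀ a {b c} → b ≡ c → a * b ≡ a * c
*-congˡ a = cong (λ z → a * z)

*-congʳ : ∀ c {a b} → a ≡ b → a * c ≡ b * c
*-congʳ c = cong (λ z → z * c)

-- Finite sums

∑ : List A → (A → ℤ) → ℤ
∑ []       f = 0ℤ
∑ (x ∷ xs) f = f x + ∑ xs f

⟦_⟧ : Bool → ℤ
⟦ true  ⟧ = 1ℤ
⟦ false ⟧ = 0ℤ

∑-cong-∈ : ∀ (xs : List A) {f g : A → ℤ} → (∀ x → x ∈ xs → f x ≡ g x) → ∑ xs f ≡ ∑ xs g
∑-cong-∈ []       h = refl
∑-cong-∈ (x ∷ xs) h = cong₂ _+_ (h x (here refl)) (∑-cong-∈ xs λ y → h y ∘ there)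

∑-cong : ∀ (xs : List A) {f g : A → ℤ} → (∀ x → f x ≡ g x) → ∑ xs f ≡ ∑ xs g
∑-cong xs h = ∑-cong-∈ xs λ x _ → h x

∑-const : ∀ (xs : List A) k → ∑ xs (λ _ → k) ≡ + length xs * k
∑-const []       k = sym (*-zeroˡ k)
∑-const (x ∷ xs) k = trans (+-congˡ k (∑-const xs k)) (sym (suc-* (+ length xs) k))

∑-0 : ∀ (xs : List A) {f : A → ℤ} → (∀ x → f x ≡ 0ℤ) → ∑ xs f ≡ 0ℤ
∑-0 xs h = trans (∑-cong xs h) (trans (∑-const xs 0ℤ) (*-zeroʳ (+ length xs)))

∑-+ : ∀ (xs : List A) (f g : A → ℤ) → ∑ xs (λ x → f x + g x) ≡ ∑ xs f + ∑ xs g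
∑-+ []       f g = refl
∑-+ (x ∷ xs) f g = trans (+-congˡ (f x + g x) (∑-+ xs f g)) (exchange (f x) (g x) (∑ xs f) (∑ xs g))
  where
  exchange : ∀ a b c d → a + b + (c + d) ≡ a + c + (b + d)
  exchange = solve-∀

∑-*ˡ : ∀ (xs : List A) k (f : A → ℤ) → ∑ xs (λ x → k * f x) ≡ k * ∑ xs f
∑-*ˡ []       k f = sym (*-zeroʳ k)
∑-*ˡ (x ∷ xs) k f = trans (+-congˡ (k * f x) (∑-*ˡ xs k f)) (sym (*-distribˡ-+ k (f x) (∑ xs f)))

∑-*ʳ : ∀ (xs : List A) (f : A → ℤ) k → ∑ xs (λ x → f x * k) ≡ ∑ xs f * k
∑-*ʳ []       f k = sym (*-zeroˡ k)
∑-*ʳ (x ∷ xs) f k = trans (+-congˡ (f x * k) (∑-*ʳ xs f k)) (sym (*-distribʳ-+ k (f x) (∑ xs f)))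

∑-minus : ∀ (xs : List A) (f g : A → ℤ) → ∑ xs (λ x → f x - g x) ≡ ∑ xs f - ∑ xs g
∑-minus []       f g = refl
∑-minus (x ∷ xs) f g = trans (+-congˡ (f x - g x) (∑-minus xs f g)) (exchange (f x) (g x) (∑ xs f) (∑ xs g))
  where
  exchange : ∀ a b c d → a - b + (c - d) ≡ a + c - (b + d)
  exchange = solve-∀

∑-swap : ∀ (xs : List A) (ys : List B) (f : A → B → ℤ) →
  ∑ xs (λ x → ∑ ys (f x)) ≡ ∑ ys (λ y → ∑ xs (λ x → f x y))
∑-swap []       ys f = sym (∑-0 ys λ _ → refl)
∑-swap (x ∷ xs) ys f =
  trans (+-congˡ (∑ ys (f x)) (∑-swap xs ys f)) (sym (∑-+ ys (f x) λ y → ∑ xs (λ z → f z y)))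

∑-map : ∀ (h : A → B) xs (f : B → ℤ) → ∑ (map h xs) f ≡ ∑ xs (f ∘ h)
∑-map h []       f = refl
∑-map h (x ∷ xs) f = +-congˡ (f (h x)) (∑-map h xs f)

∑-++ : ∀ (xs ys : List A) f → ∑ (xs ++ ys) f ≡ ∑ xs f + ∑ ys f
∑-++ []       ys f = sym (+-identityˡ (∑ ys f))
∑-++ (x ∷ xs) ys f = trans (+-congˡ (f x) (∑-++ xs ys f)) (sym (+-assoc (f x) (∑ xs f) (∑ ys f)))

∑-concatMap : ∀ (h : A → List B) xs f → ∑ (concatMap h xs) f ≡ ∑ xs (λ x → ∑ (h x) f)
∑-concatMap h []       f = refl
∑-concatMap h (x ∷ xs) f = trans (∑-++ (h x) (concatMap h xs) f) (+-congˡ (∑ (h x) f) (∑-concatMap h xs f))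

length-filter-∑ : ∀ {P : A → Set} (P? : ∀ x → Dec (P x)) xs →
  + length (filter P? xs) ≡ ∑ xs (λ x → ⟦ does (P? x) ⟧)
length-filter-∑ P? []       = refl
length-filter-∑ P? (x ∷ xs) with does (P? x)
... | true  = +-congˡ 1ℤ (length-filter-∑ P? xs)
... | false = trans (length-filter-∑ P? xs) (sym (+-identityˡ (∑ xs λ y → ⟦ does (P? y) ⟧)))

∑-allFin-suc : ∀ n (f : Fin (suc n) → ℤ) → ∑ (allFin (suc n)) f ≡ f zero + ∑ (allFin n) (f ∘ suc)
∑-allFin-suc n f = +-congˡ (f zero)
  (trans (cong (λ xs → ∑ xs f) (sym (map-tabulate id suc))) (∑-map suc (allFin n) f))

-- The list runs downwards, so the definition of `∑` splits off the top index; Pascal's rule and the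
-- removal of small indices need the bottom one.
∑-downFrom-suc : ∀ n (f : ℕ → ℤ) → ∑ (downFrom (suc n)) f ≡ f 0 + ∑ (downFrom n) (f ∘ suc)
∑-downFrom-suc zero    f = refl
∑-downFrom-suc (suc n) f =
  trans (+-congˡ (f (suc n)) (∑-downFrom-suc n f))
    (exchange (f (suc n)) (f 0) (∑ (downFrom n) (f ∘ suc)))
  where
  exchange : ∀ a b c → a + (b + c) ≡ b + (a + c)
  exchange = solve-∀

==-refl : ∀ {n} (i : Fin n) → (i == i) ≡ true
==-refl i = dec-true (i ≟ᶠ i) refl

==⇒≡ : ∀ {n} (i j : Fin n) → (i == j) ≡ true → i ≡ j
==⇒≡ i j h with i ≟ᶠ j
... | yes i≡j = i≡j

≢⇒== : ∀ {n} {i j : Fin n} → i ≢ j → (i == j) ≡ false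
≢⇒== {i = i} {j} = dec-false (i ≟ᶠ j)

∑-δ : ∀ n (j : Fin n) (f : Fin n → ℤ) → ∑ (allFin n) (λ i → ⟦ i == j ⟧ * f i) ≡ f j
∑-δ (suc n) zero f = begin
  ∑ (allFin (suc n)) (λ i → ⟦ i == zero ⟧ * f i)
    ≡⟨ ∑-allFin-suc n (λ i → ⟦ i == zero ⟧ * f i) ⟩
  1ℤ * f zero + ∑ (allFin n) (λ i → 0ℤ * f (suc i))
    ≡⟨ cong₂ _+_ (*-identityˡ (f zero)) (∑-0 (allFin n) λ i → *-zeroˡ (f (suc i))) ⟩
  f zero + 0ℤ
    ≡⟨ +-identityʳ (f zero) ⟩
  f zero ∎
∑-δ (suc n) (suc j) f = begin
  ∑ (allFin (suc n)) (λ i → ⟦ i == suc j ⟧ * f i)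
    ≡⟨ ∑-allFin-suc n (λ i → ⟦ i == suc j ⟧ * f i) ⟩
  0ℤ * f zero + ∑ (allFin n) (λ i → ⟦ suc i == suc j ⟧ * f (suc i))
    ≡⟨ cong (λ z → z + ∑ (allFin n) (λ i → ⟦ i == j ⟧ * f (suc i))) (*-zeroˡ (f zero)) ⟩
  0ℤ + ∑ (allFin n) (λ i → ⟦ i == j ⟧ * f (suc i))
    ≡⟨ +-identityˡ (∑ (allFin n) (λ i → ⟦ i == j ⟧ * f (suc i))) ⟩
  ∑ (allFin n) (λ i → ⟦ i == j ⟧ * f (suc i))
    ≡⟨ ∑-δ n j (f ∘ suc) ⟩
  f (suc j) ∎

-- Falling factorial moments of the number of starting edges

picks : List A → List (A × List A)
picks []       = []
picks (x ∷ xs) = (x , xs) ∷ map (λ p → proj₁ p , x ∷ proj₂ p) (picks xs)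

∑-picks : ∀ (xs : List A) (f : A → ℤ) → ∑ (picks xs) (f ∘ proj₁) ≡ ∑ xs f
∑-picks []       f = refl
∑-picks (x ∷ xs) f = +-congˡ (f x) (trans (∑-map _ (picks xs) (f ∘ proj₁)) (∑-picks xs f))

picks-∑ : ∀ (xs : List A) {e r} → (e , r) ∈ picks xs → ∀ f → ∑ xs f ≡ f e + ∑ r f
picks-∑ (x ∷ xs) (here refl) f = refl
picks-∑ (x ∷ xs) (there e∈) f with ∈-map⁻ _ e∈
... | (e , r) , e∈′ , refl =
  trans (+-congˡ (f x) (picks-∑ xs e∈′ f)) (exchange (f x) (f e) (∑ r f))
  where
  exchange : ∀ a b c → a + (b + c) ≡ b + (a + c)
  exchange = solve-∀

picks-length : ∀ (xs : List A) {e r} → (e , r) ∈ picks xs → length xs ≡ suc (length r)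
picks-length (x ∷ xs) (here refl) = refl
picks-length (x ∷ xs) (there e∈) with ∈-map⁻ _ e∈
... | (e , r) , e∈′ , refl = cong suc (picks-length xs e∈′)

-- `orderings` inserts the head into orderings of the tail, whereas conditioning on the first
-- processed edge groups orderings by their first entry. Inductively, `x` goes either in front of
-- everything, which gives `front`, or behind the first entry, which gives `back`.
∑-orderings : ∀ (x : A) xs (f : List A → ℤ) →
  ∑ (orderings (x ∷ xs)) f ≡ ∑ (picks (x ∷ xs)) (λ p → ∑ (orderings (proj₂ p)) (λ σ → f (proj₁ p ∷ σ)))
∑-orderings x []           f = cong (λ z → z + 0ℤ) (sym (+-identityʳ (f (x ∷ []))))
∑-orderings {A} x xs@(y ∷ ys) f = begin
  ∑ (orderings (x ∷ xs)) f
    ≡⟨ ∑-concatMap (insertions x) (orderings xs) f ⟩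
  ∑ (orderings xs) (λ σ → ∑ (insertions x σ) f)
    ≡⟨ ∑-orderings y ys (λ σ → ∑ (insertions x σ) f) ⟩
  ∑ (picks xs) (λ p → ∑ (orderings (proj₂ p)) (λ σ → f (x ∷ proj₁ p ∷ σ) + ∑ (map (proj₁ p ∷_) (insertions x σ)) f))
    ≡⟨ ∑-cong (picks xs) (λ p → trans
         (∑-+ (orderings (proj₂ p)) (λ σ → f (x ∷ proj₁ p ∷ σ)) (λ σ → ∑ (map (proj₁ p ∷_) (insertions x σ)) f))
         (+-congˡ (front p) (trans
           (∑-cong (orderings (proj₂ p)) λ σ → ∑-map (proj₁ p ∷_) (insertions x σ) f)
           (sym (∑-concatMap (insertions x) (orderings (proj₂ p)) λ σ → f (proj₁ p ∷ σ)))))) ⟩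
  ∑ (picks xs) (λ p → front p + back p)
    ≡⟨ ∑-+ (picks xs) front back ⟩
  ∑ (picks xs) front + ∑ (picks xs) back
    ≡⟨ cong₂ _+_ (sym (∑-orderings y ys λ σ → f (x ∷ σ))) 
         (sym (∑-map (λ p → proj₁ p , x ∷ proj₂ p) (picks xs) (λ p → ∑ (orderings (proj₂ p)) (λ σ → f (proj₁ p ∷ σ))))) ⟩
  ∑ (picks (x ∷ xs)) (λ p → ∑ (orderings (proj₂ p)) (λ σ → f (proj₁ p ∷ σ))) ∎
  where
  front back : A × List A → ℤ
  front p = ∑ (orderings (proj₂ p)) (λ σ → f (x ∷ proj₁ p ∷ σ))
  back  p = ∑ (orderings (x ∷ proj₂ p)) (λ σ → f (proj₁ p ∷ σ))

-- Falling factorials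

falling : ℤ → ℕ → ℤ
falling x zero    = 1ℤ
falling x (suc r) = x * falling (x - 1ℤ) r

falling-last : ∀ x r → falling x (suc r) ≡ falling x r * (x - + r)
falling-last x zero    = lemma x
  where
  lemma : ∀ x → x * 1ℤ ≡ 1ℤ * (x - 0ℤ)
  lemma = solve-∀
falling-last x (suc r) = trans (*-congˡ x (falling-last (x - 1ℤ) r)) (lemma x (falling (x - 1ℤ) r) (+ r))
  where
  lemma : ∀ x y r → x * (y * (x - 1ℤ - r)) ≡ x * y * (x - (1ℤ + r))
  lemma = solve-∀

-- The difference rule: one more starting edge adds r times the falling factorial of order r - 1. At
-- r = 0 the factor `+ r` kills the term with the default `pred 0`.
falling-suc : ∀ x r → falling (1ℤ + x) r ≡ falling x r + + r * falling x (pred r)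
falling-suc x zero    = refl
falling-suc x (suc r) = begin
  (1ℤ + x) * falling (1ℤ + x - 1ℤ) r       ≡⟨ cong (λ z → (1ℤ + x) * falling z r) (lemma₁ x) ⟩
  (1ℤ + x) * falling x r                   ≡⟨ lemma₂ x (falling x r) (+ r) ⟩
  falling x r * (x - + r) + + suc r * falling x r ≡⟨ cong (λ z → z + + suc r * falling x r) (sym (falling-last x r)) ⟩
  falling x (suc r) + + suc r * falling x r     ∎
  where
  lemma₁ : ∀ x → 1ℤ + x - 1ℤ ≡ x
  lemma₁ = solve-∀
  lemma₂ : ∀ x y r → (1ℤ + x) * y ≡ y * (x - r) + (1ℤ + r) * y
  lemma₂ = solve-∀

-- The common factor r allows `falling-last` to be used at `pred r` without a case split at r = 0.
falling-r : ∀ x r → + r * falling x r ≡ + r * (falling x (pred r) * (x - + pred r))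
falling-r x zero    = refl
falling-r x (suc r) = *-congˡ (+ suc r) (falling-last x r)

-- The state of the process: covered vertices and starting edges

cover : ∀ {n} → (Fin n → Bool) → Fin n × Fin n → Fin n → Bool
cover c (u , v) w = c w ∨ (w == u) ∨ (w == v)

new : ∀ {n} → (Fin n → Bool) → Fin n × Fin n → Bool
new c (u , v) = not (c u) ∧ not (c v)

starts : ∀ {n} → (Fin n → Bool) → List (Fin n × Fin n) → ℕ
starts c []       = 0
starts c (e ∷ es) = if new c e then suc (starts (cover c e) es) else starts (cover c e) es

uncovered : ∀ {n} → (Fin n → Bool) → ℤ
uncovered {n} c = ∑ (allFin n) (λ i → ⟦ not (c i) ⟧)

uncovered-cong : ∀ {n} {c d : Fin n → Bool} → (∀ i → c i ≡ d i) → uncovered c ≡ uncovered d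
uncovered-cong h = ∑-cong (allFin _) λ i → cong (⟦_⟧ ∘ not) (h i)

uncovered-∨ : ∀ {n} (c : Fin n → Bool) j →
  uncovered (λ i → c i ∨ (i == j)) ≡ uncovered c - ⟦ not (c j) ⟧
uncovered-∨ {n} c j = begin
  ∑ (allFin n) (λ i → ⟦ not (c i ∨ (i == j)) ⟧)
    ≡⟨ ∑-cong (allFin n) (λ i → pointwise (c i) (i == j)) ⟩
  ∑ (allFin n) (λ i → ⟦ not (c i) ⟧ - ⟦ i == j ⟧ * ⟦ not (c i) ⟧)
    ≡⟨ ∑-minus (allFin n) (λ i → ⟦ not (c i) ⟧) (λ i → ⟦ i == j ⟧ * ⟦ not (c i) ⟧) ⟩
  uncovered c - ∑ (allFin n) (λ i → ⟦ i == j ⟧ * ⟦ not (c i) ⟧)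
    ≡⟨ cong (λ z → uncovered c - z) (∑-δ n j (λ i → ⟦ not (c i) ⟧)) ⟩
  uncovered c - ⟦ not (c j) ⟧ ∎
  where
  pointwise : ∀ x y → ⟦ not (x ∨ y) ⟧ ≡ ⟦ not x ⟧ - ⟦ y ⟧ * ⟦ not x ⟧
  pointwise true  true  = refl
  pointwise true  false = refl
  pointwise false true  = refl
  pointwise false false = refl

↑ˡ≢↑ʳ : ∀ {s t} (i : Fin s) (j : Fin t) → i ↑ˡ t ≢ s ↑ʳ j
↑ˡ≢↑ʳ {s} {t} i j eq
  with () ← trans (sym (splitAt-↑ˡ s i t)) (trans (cong (splitAt s) eq) (splitAt-↑ʳ s t j))

==-injective : ∀ {m n} {f : Fin m → Fin n} → (∀ {i j} → f i ≡ f j → i ≡ j) →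
  ∀ i j → (f i == f j) ≡ (i == j)
==-injective {f = f} inj i j with i ≟ᶠ j
... | yes refl = ==-refl (f i)
... | no  i≢j  = ≢⇒== (i≢j ∘ inj)

-- With `f` and `g` the indicators of uncovered ends, every function of an edge that depends only on
-- which ends are uncovered, and is zero if neither is, has this form. Its sum over all pairs then
-- sees only the numbers of uncovered vertices.
∑∑-bilinear : ∀ (xs : List A) (ys : List B) (f : A → ℤ) (g : B → ℤ) k x y →
  ∑ xs (λ i → ∑ ys (λ j → f i * (g j * k) + (f i * x + g j * y)))
    ≡ ∑ xs f * (∑ ys g * k) + (+ length ys * (∑ xs f * x) + + length xs * (∑ ys g * y))
∑∑-bilinear xs ys f g k x y = begin
  ∑ xs (λ i → ∑ ys (λ j → f i * (g j * k) + (f i * x + g j * y)))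
    ≡⟨ ∑-cong xs (λ i → trans (∑-cong ys λ j → regroup (f i) (g j) k x y) (inner i)) ⟩
  ∑ xs (λ i → ∑ ys g * (f i * k + y) + + length ys * (f i * x))
    ≡⟨ ∑-cong xs (λ i → regroup′ (f i) (∑ ys g) k x y (+ length ys)) ⟩
  ∑ xs (λ i → f i * (∑ ys g * k + + length ys * x) + ∑ ys g * y)
    ≡⟨ ∑-+ xs (λ i → f i * (∑ ys g * k + + length ys * x)) (λ _ → ∑ ys g * y) ⟩
  ∑ xs (λ i → f i * (∑ ys g * k + + length ys * x)) + ∑ xs (λ _ → ∑ ys g * y)
    ≡⟨ cong₂ _+_ (∑-*ʳ xs f (∑ ys g * k + + length ys * x)) (∑-const xs (∑ ys g * y)) ⟩
  ∑ xs f * (∑ ys g * k + + length ys * x) + + length xs * (∑ ys g * y)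
    ≡⟨ regroup″ (∑ xs f) (∑ ys g) k x y (+ length xs) (+ length ys) ⟩
  ∑ xs f * (∑ ys g * k) + (+ length ys * (∑ xs f * x) + + length xs * (∑ ys g * y)) ∎
  where
  regroup : ∀ f g k x y → f * (g * k) + (f * x + g * y) ≡ g * (f * k + y) + f * x
  regroup = solve-∀
  regroup′ : ∀ f g k x y n → g * (f * k + y) + n * (f * x) ≡ f * (g * k + n * x) + g * y
  regroup′ = solve-∀
  regroup″ : ∀ f g k x y m n → f * (g * k + n * x) + m * (g * y) ≡ f * (g * k) + (n * (f * x) + m * (g * y))
  regroup″ = solve-∀
  inner : ∀ i → ∑ ys (λ j → g j * (f i * k + y) + f i * x) ≡ ∑ ys g * (f i * k + y) + + length ys * (f i * x)
  inner i = trans (∑-+ ys (λ j → g j * (f i * k + y)) (λ _ → f i * x))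
    (cong₂ _+_ (∑-*ʳ ys g (f i * k + y)) (∑-const ys (f i * x)))

length-allFin : ∀ n → length (allFin n) ≡ n
length-allFin n = length-tabulate id

uncovered-∅ : ∀ n → uncovered {n} (λ _ → false) ≡ + n
uncovered-∅ n = trans (∑-const (allFin n) 1ℤ) (trans (*-identityʳ _) (cong +_ (length-allFin n)))

-- The moment recursion on K_{s,t}

module Bipartite (s t : ℕ) where

  V : Set
  V = Fin (s ℕ.+ t)

  rows cols : (V → Bool) → ℤ
  rows c = uncovered λ (i : Fin s) → c (i ↑ˡ t)
  cols c = uncovered λ (j : Fin t) → c (s ↑ʳ j)

  Ks,t : List (V × V)
  Ks,t = edges (K s t)

  ∑-edges : ∀ f → ∑ Ks,t f ≡ ∑ (allFin s) (λ i → ∑ (allFin t) (λ j → f (i ↑ˡ t , s ↑ʳ j)))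
  ∑-edges f = trans
    (∑-concatMap (λ i → map (λ j → i ↑ˡ t , s ↑ʳ j) (allFin t)) (allFin s) f)
    (∑-cong (allFin s) λ i → ∑-map (λ j → i ↑ˡ t , s ↑ʳ j) (allFin t) f)

  rows-cover : ∀ c i j → rows (cover c (i ↑ˡ t , s ↑ʳ j)) ≡ rows c - ⟦ not (c (i ↑ˡ t)) ⟧
  rows-cover c i j = trans
    (uncovered-cong λ k → cong (c (k ↑ˡ t) ∨_) (trans
      (cong₂ _∨_ (==-injective (λ {x} {y} → ↑ˡ-injective t x y) k i) (≢⇒== (↑ˡ≢↑ʳ k j)))
      (∨-identityʳ (k == i))))
    (uncovered-∨ (λ k → c (k ↑ˡ t)) i)

  cols-cover : ∀ c i j → cols (cover c (i ↑ˡ t , s ↑ʳ j)) ≡ cols c - ⟦ not (c (s ↑ʳ j)) ⟧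
  cols-cover c i j = trans
    (uncovered-cong λ k → cong (c (s ↑ʳ k) ∨_)
      (cong₂ _∨_ (≢⇒== (↑ˡ≢↑ʳ i k ∘ sym)) (==-injective (λ {x} {y} → ↑ʳ-injective s x y) k j)))
    (uncovered-∨ (λ k → c (s ↑ʳ k)) j)

  N : ℤ
  N = + s + + t - 1ℤ

  -- The edges with an uncovered end are the same in E and in K_{s,t}, stated
  -- through sums of functions that vanish on all other edges.
  Pending : List (V × V) → (V → Bool) → Set
  Pending E c = ∀ f → (∀ u v → c u ≡ true → c v ≡ true → f (u , v) ≡ 0ℤ) → ∑ E f ≡ ∑ Ks,t f

  H : (V → Bool) → ℕ → ℤ
  H c r = falling (rows c) r * falling (cols c) r

  -- The orderings of E that begin with e contribute (|E| - 1)! times this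
  -- weight to falling N r times the r-th moment.
  weight : (V → Bool) → ℕ → V × V → ℤ
  weight c r e = H (cover c e) r + ⟦ new c e ⟧ * (+ r * ((N - + pred r) * H (cover c e) (pred r)))

  -- Such an edge leaves the state as it is and starts nothing; this makes the excess over `H c r`
  -- an admissible test function for `Pending`.
  weight-covered : ∀ c r u v → c u ≡ true → c v ≡ true → weight c r (u , v) - H c r ≡ 0ℤ
  weight-covered c r u v cu cv = begin
    weight c r (u , v) - H c r
      ≡⟨ cong (λ z → H (cover c (u , v)) r + ⟦ z ⟧ * y - H c r) (cong₂ (λ x x′ → not x ∧ not x′) cu cv) ⟩
    H (cover c (u , v)) r + 0ℤ * y - H c r
      ≡⟨ cong (λ z → z + 0ℤ * y - H c r) (cong₂ (λ x x′ → falling x r * falling x′ r)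
           (uncovered-cong λ i → same (i ↑ˡ t)) (uncovered-cong λ i → same (s ↑ʳ i))) ⟩
    H c r + 0ℤ * y - H c r
      ≡⟨ lemma (H c r) y ⟩
    0ℤ ∎
    where
    y : ℤ
    y = + r * ((N - + pred r) * H (cover c (u , v)) (pred r))
    same : ∀ w → cover c (u , v) w ≡ c w
    same w with c w in cw
    ... | true  = refl
    ... | false with w == u in w=u | w == v in w=v
    ...   | true  | _     = trans (sym (trans (cong c (==⇒≡ w u w=u)) cu)) cw
    ...   | false | true  = trans (sym (trans (cong c (==⇒≡ w v w=v)) cv)) cw
    ...   | false | false = refl
    lemma : ∀ x y → x + 0ℤ * y - x ≡ 0ℤ
    lemma = solve-∀

  module _ (c : V → Bool) (r : ℕ) where
    private
      a b φ₁₁ φ₁₀ φ₀₁ : ℤ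
      a = rows c
      b = cols c
      -- Excess of the weight over `H c r` when both ends, only the first, or only the second end of
      -- the edge is uncovered.
      φ₁₁ = falling (a - 1ℤ) r * falling (b - 1ℤ) r + + r * ((N - + pred r) * (falling (a - 1ℤ) (pred r) * falling (b - 1ℤ) (pred r))) - H c r
      φ₁₀ = falling (a - 1ℤ) r * falling b r - H c r
      φ₀₁ = falling a r * falling (b - 1ℤ) r - H c r

    -- The polynomial in the indicators `p` and `q` that interpolates the four values 0, `φ₁₀`,
    -- `φ₀₁`, `φ₁₁`; in this shape the double sum factors.
    weight-edge : ∀ i j → let p = ⟦ not (c (i ↑ˡ t)) ⟧ ; q = ⟦ not (c (s ↑ʳ j)) ⟧ in
      weight c r (i ↑ˡ t , s ↑ʳ j) - H c r ≡ p * (q * (φ₁₁ - φ₁₀ - φ₀₁)) + (p * φ₁₀ + q * φ₀₁)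
    weight-edge i j rewrite rows-cover c i j | cols-cover c i j with c (i ↑ˡ t) | c (s ↑ʳ j)
    ... | true | true rewrite +-identityʳ a | +-identityʳ b =
      lemma (H c r) (+ r * ((N - + pred r) * H c (pred r))) φ₁₁ φ₁₀ φ₀₁
      where
      lemma : ∀ h y x₁₁ x₁₀ x₀₁ → h + 0ℤ * y - h ≡ 0ℤ * (0ℤ * (x₁₁ - x₁₀ - x₀₁)) + (0ℤ * x₁₀ + 0ℤ * x₀₁)
      lemma = solve-∀
    ... | true | false rewrite +-identityʳ a =
      lemma (falling a r * falling (b - 1ℤ) r) (H c r) (+ r * ((N - + pred r) * (falling a (pred r) * falling (b - 1ℤ) (pred r)))) φ₁₁ φ₁₀
      where
      lemma : ∀ x h y x₁₁ x₁₀ → x + 0ℤ * y - h ≡ 0ℤ * (1ℤ * (x₁₁ - x₁₀ - (x - h))) + (0ℤ * x₁₀ + 1ℤ * (x - h))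
      lemma = solve-∀
    ... | false | true rewrite +-identityʳ b =
      lemma (falling (a - 1ℤ) r * falling b r) (H c r) (+ r * ((N - + pred r) * (falling (a - 1ℤ) (pred r) * falling b (pred r)))) φ₁₁ φ₀₁
      where
      lemma : ∀ x h y x₁₁ x₀₁ → x + 0ℤ * y - h ≡ 1ℤ * (0ℤ * (x₁₁ - (x - h) - x₀₁)) + (1ℤ * (x - h) + 0ℤ * x₀₁)
      lemma = solve-∀
    ... | false | false =
      lemma (falling (a - 1ℤ) r * falling (b - 1ℤ) r) (H c r) (+ r * ((N - + pred r) * (falling (a - 1ℤ) (pred r) * falling (b - 1ℤ) (pred r)))) φ₁₀ φ₀₁
      where
      lemma : ∀ x h y x₁₀ x₀₁ → x + 1ℤ * y - h ≡ 1ℤ * (1ℤ * (x + y - h - x₁₀ - x₀₁)) + (1ℤ * x₁₀ + 1ℤ * x₀₁)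
      lemma = solve-∀

    private
      -- Here N - (r - 1) = s + t - r, which makes the weights balance.
      drop : a * (b * (+ r * ((N - + pred r) * (falling (a - 1ℤ) (pred r) * falling (b - 1ℤ) (pred r)))))
        ≡ + r * ((+ s + + t - + r) * H c r)
      drop = go r
        where
        go : ∀ r → a * (b * (+ r * ((N - + pred r) * (falling (a - 1ℤ) (pred r) * falling (b - 1ℤ) (pred r)))))
          ≡ + r * ((+ s + + t - + r) * (falling a r * falling b r))
        go zero    = trans (*-congˡ a (*-zeroʳ b)) (*-zeroʳ a)
        go (suc q) = lemma a b (+ s) (+ t) (+ q) (falling (a - 1ℤ) q) (falling (b - 1ℤ) q)
          where
          lemma : ∀ a b s t q x y → a * (b * ((1ℤ + q) * ((s + t - 1ℤ - q) * (x * y))))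
            ≡ (1ℤ + q) * ((s + t - (1ℤ + q)) * (a * x * (b * y)))
          lemma = solve-∀

    ∑-weight : ∑ Ks,t (λ e → weight c r e - H c r) ≡ 0ℤ
    ∑-weight = begin
      ∑ Ks,t (λ e → weight c r e - H c r)
        ≡⟨ ∑-edges (λ e → weight c r e - H c r) ⟩
      ∑ (allFin s) (λ i → ∑ (allFin t) (λ j → weight c r (i ↑ˡ t , s ↑ʳ j) - H c r))
        ≡⟨ ∑-cong (allFin s) (λ i → ∑-cong (allFin t) λ j → weight-edge i j) ⟩
      ∑ (allFin s) (λ i → ∑ (allFin t) (λ j → p i * (q j * k) + (p i * φ₁₀ + q j * φ₀₁)))
        ≡⟨ ∑∑-bilinear (allFin s) (allFin t) p q k φ₁₀ φ₀₁ ⟩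
      a * (b * k) + (+ length (allFin t) * (a * φ₁₀) + + length (allFin s) * (b * φ₀₁))
        ≡⟨ cong₂ (λ m n → a * (b * k) + (+ m * (a * φ₁₀) + + n * (b * φ₀₁))) (length-allFin t) (length-allFin s) ⟩
      a * (b * k) + (+ t * (a * φ₁₀) + + s * (b * φ₀₁))
        ≡⟨ expand a b (+ s) (+ t) (falling (a - 1ℤ) r) (falling (b - 1ℤ) r) (falling a r) (falling b r) y ⟩
      F (a * falling (a - 1ℤ) r) (b * falling (b - 1ℤ) r) (a * (b * y))
        ≡⟨ cong₂ (λ u v → F u v (a * (b * y))) (falling-last a r) (falling-last b r) ⟩
      F (falling a r * (a - + r)) (falling b r * (b - + r)) (a * (b * y))
        ≡⟨ cong (F (falling a r * (a - + r)) (falling b r * (b - + r))) drop ⟩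
      F (falling a r * (a - + r)) (falling b r * (b - + r)) (+ r * ((+ s + + t - + r) * H c r))
        ≡⟨ cancel a b (+ s) (+ t) (+ r) (falling a r) (falling b r) ⟩
      0ℤ ∎
      where
      p : Fin s → ℤ
      p i = ⟦ not (c (i ↑ˡ t)) ⟧
      q : Fin t → ℤ
      q j = ⟦ not (c (s ↑ʳ j)) ⟧
      k y : ℤ
      k = φ₁₁ - φ₁₀ - φ₀₁
      y = + r * ((N - + pred r) * (falling (a - 1ℤ) (pred r) * falling (b - 1ℤ) (pred r)))
      -- Isolates `a * falling (a - 1ℤ) r`, which is `falling a (suc r)`, and its analogue for `b`,
      -- so that `falling-last` and `drop` make every term a multiple of `H c r`.
      F : ℤ → ℤ → ℤ → ℤ
      F u v w = u * v + w + a * (b * H c r) + ((+ t - b) * (u * falling b r) + (+ s - a) * (falling a r * v))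
        - (+ t * (a * H c r) + + s * (b * H c r))
      expand : ∀ a b s t α β x z y →
        a * (b * (α * β + y - x * z - (α * z - x * z) - (x * β - x * z))) + (t * (a * (α * z - x * z)) + s * (b * (x * β - x * z)))
        ≡ (a * α) * (b * β) + a * (b * y) + a * (b * (x * z)) + ((t - b) * ((a * α) * z) + (s - a) * (x * (b * β)))
          - (t * (a * (x * z)) + s * (b * (x * z)))
      expand = solve-∀
      cancel : ∀ a b s t r x z →
        (x * (a - r)) * (z * (b - r)) + r * ((s + t - r) * (x * z)) + a * (b * (x * z))
          + ((t - b) * ((x * (a - r)) * z) + (s - a) * (x * (z * (b - r))))
          - (t * (a * (x * z)) + s * (b * (x * z))) ≡ 0ℤ
      cancel = solve-∀

  -- `Pending` transfers only functions that vanish on covered edges, hence the detour through the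
  -- difference to the constant `H c r`.
  ∑-weight-pending : ∀ E c r → Pending E c → ∑ E (weight c r) ≡ + length E * H c r
  ∑-weight-pending E c r pending = i-j≡0⇒i≡j (∑ E (weight c r)) (+ length E * H c r) (begin
    ∑ E (weight c r) - + length E * H c r
      ≡⟨ cong (λ z → ∑ E (weight c r) - z) (sym (∑-const E (H c r))) ⟩
    ∑ E (weight c r) - ∑ E (λ _ → H c r)
      ≡⟨ sym (∑-minus E (weight c r) (λ _ → H c r)) ⟩
    ∑ E (λ e → weight c r e - H c r)
      ≡⟨ pending (λ e → weight c r e - H c r) (weight-covered c r) ⟩
    ∑ Ks,t (λ e → weight c r e - H c r)
      ≡⟨ ∑-weight c r ⟩
    0ℤ ∎)

  -- Both ends of the removed edge are covered in the new state, so an admissible `f` is zero on it.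
  -- Covering more vertices asks `f` to vanish on more edges, so `f` was admissible before as well.
  pending-cover : ∀ {E c e r} → (e , r) ∈ picks E → Pending E c → Pending r (cover c e)
  pending-cover {E} {c} {u , v} {r} e∈ pending f vanish = begin
    ∑ r f                    ≡⟨ sym (+-identityˡ (∑ r f)) ⟩
    0ℤ + ∑ r f               ≡⟨ cong (λ z → z + ∑ r f) (sym (vanish u v u-covered v-covered)) ⟩
    f (u , v) + ∑ r f        ≡⟨ sym (picks-∑ E e∈ f) ⟩
    ∑ E f                    ≡⟨ pending f (λ x y cx cy → vanish x y (keep x cx) (keep y cy)) ⟩
    ∑ Ks,t f                 ∎
    where
    keep : ∀ w → c w ≡ true → cover c (u , v) w ≡ true
    keep w cw rewrite cw = refl
    u-covered : cover c (u , v) u ≡ true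
    u-covered rewrite ==-refl u = ∨-zeroʳ (c u)
    v-covered : cover c (u , v) v ≡ true
    v-covered rewrite ==-refl v | ∨-zeroʳ (v == u) = ∨-zeroʳ (c v)

  -- The invariant is tested on the indicator of an uncovered first end, which counts every
  -- uncovered vertex of the first part t times.
  rows-pending : .{{_ : NonZero t}} → ∀ c → Pending [] c → rows c ≡ 0ℤ
  rows-pending c pending = *-cancelˡ-≡ (+ t) (rows c) 0ℤ (begin
    + t * rows c
      ≡⟨ sym (∑-*ˡ (allFin s) (+ t) p) ⟩
    ∑ (allFin s) (λ i → + t * p i)
      ≡⟨ ∑-cong (allFin s) (λ i → trans (cong (λ n → + n * p i) (sym (length-allFin t))) (sym (∑-const (allFin t) (p i)))) ⟩
    ∑ (allFin s) (λ i → ∑ (allFin t) (λ _ → p i))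
      ≡⟨ sym (∑-edges f) ⟩
    ∑ Ks,t f
      ≡⟨ sym (pending f (λ u v cu _ → cong (⟦_⟧ ∘ not) cu)) ⟩
    0ℤ
      ≡⟨ sym (*-zeroʳ (+ t)) ⟩
    + t * 0ℤ ∎)
    where
    p : Fin s → ℤ
    p i = ⟦ not (c (i ↑ˡ t)) ⟧
    f : V × V → ℤ
    f (u , v) = ⟦ not (c u) ⟧

  -- Summed over the orderings and not averaged, so it is |E|! times the expectation.
  moment : List (V × V) → (V → Bool) → ℕ → ℤ
  moment E c r = ∑ (orderings E) (λ σ → falling (+ starts c σ) r)

  moment-step : ∀ x xs c r → moment (x ∷ xs) c r ≡ ∑ (picks (x ∷ xs)) (λ p →
    moment (proj₂ p) (cover c (proj₁ p)) r + ⟦ new c (proj₁ p) ⟧ * (+ r * moment (proj₂ p) (cover c (proj₁ p)) (pred r)))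
  moment-step x xs c r = trans
    (∑-orderings x xs (λ σ → falling (+ starts c σ) r))
    (∑-cong (picks (x ∷ xs)) λ (e , E) → begin
      ∑ (orderings E) (λ σ → falling (+ starts c (e ∷ σ)) r)
        ≡⟨ ∑-cong (orderings E) (λ σ → first-edge e σ) ⟩
      ∑ (orderings E) (λ σ → falling (+ starts (cover c e) σ) r + ⟦ new c e ⟧ * (+ r * falling (+ starts (cover c e) σ) (pred r)))
        ≡⟨ ∑-+ (orderings E) (λ σ → falling (+ starts (cover c e) σ) r) (λ σ → ⟦ new c e ⟧ * (+ r * falling (+ starts (cover c e) σ) (pred r))) ⟩
      moment E (cover c e) r + ∑ (orderings E) (λ σ → ⟦ new c e ⟧ * (+ r * falling (+ starts (cover c e) σ) (pred r)))
        ≡⟨ +-congˡ (moment E (cover c e) r) (trans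
             (∑-*ˡ (orderings E) ⟦ new c e ⟧ (λ σ → + r * falling (+ starts (cover c e) σ) (pred r)))
             (*-congˡ ⟦ new c e ⟧ (∑-*ˡ (orderings E) (+ r) (λ σ → falling (+ starts (cover c e) σ) (pred r))))) ⟩
      moment E (cover c e) r + ⟦ new c e ⟧ * (+ r * moment E (cover c e) (pred r)) ∎)
    where
    first-edge : ∀ e σ → falling (+ starts c (e ∷ σ)) r
      ≡ falling (+ starts (cover c e) σ) r + ⟦ new c e ⟧ * (+ r * falling (+ starts (cover c e) σ) (pred r))
    first-edge e σ with new c e
    ... | true  = trans (falling-suc (+ starts (cover c e) σ) r)
      (+-congˡ (falling (+ starts (cover c e) σ) r) (sym (*-identityˡ (+ r * falling (+ starts (cover c e) σ) (pred r)))))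
    ... | false = sym (trans
      (+-congˡ (falling (+ starts (cover c e) σ) r) (*-zeroˡ (+ r * falling (+ starts (cover c e) σ) (pred r))))
      (+-identityʳ (falling (+ starts (cover c e) σ) r)))

  -- Induction on the number of remaining edges for all r at once, since a starting edge brings in
  -- order r - 1. The length is a separate argument because the recursion goes to the remainders in
  -- `picks`, which are not sublists syntactically.
  moment-pending : .{{_ : NonZero t}} → ∀ m E c → length E ≡ m → Pending E c → ∀ r →
    moment E c r * falling N r ≡ + (m !) * H c r
  moment-pending zero    []       c refl pending zero    = refl
  -- No starting edge is left to come, and `rows c` is zero, so both sides vanish.
  moment-pending zero    []       c refl pending (suc r)
    rewrite rows-pending c pending = refl
  moment-pending (suc m) (x ∷ xs) c len pending r = begin
    moment (x ∷ xs) c r * falling N r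
      ≡⟨ *-congʳ (falling N r) (moment-step x xs c r) ⟩
    ∑ (picks (x ∷ xs)) (λ p → summand p) * falling N r
      ≡⟨ sym (∑-*ʳ (picks (x ∷ xs)) summand (falling N r)) ⟩
    ∑ (picks (x ∷ xs)) (λ p → summand p * falling N r)
      ≡⟨ ∑-cong-∈ (picks (x ∷ xs)) (λ (e , E) e∈ → step e E
           (moment-pending m E (cover c e) (ℕ.suc-injective (trans (sym (picks-length (x ∷ xs) e∈)) len)) (pending-cover e∈ pending))) ⟩
    ∑ (picks (x ∷ xs)) (λ p → + (m !) * weight c r (proj₁ p))
      ≡⟨ ∑-*ˡ (picks (x ∷ xs)) (+ (m !)) (weight c r ∘ proj₁) ⟩
    + (m !) * ∑ (picks (x ∷ xs)) (weight c r ∘ proj₁)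
      ≡⟨ *-congˡ (+ (m !)) (∑-picks (x ∷ xs) (weight c r)) ⟩
    + (m !) * ∑ (x ∷ xs) (weight c r)
      ≡⟨ *-congˡ (+ (m !)) (trans (∑-weight-pending (x ∷ xs) c r pending) (cong (λ n → + n * H c r) len)) ⟩
    + (m !) * (+ suc m * H c r)
      ≡⟨ lemma (+ (m !)) (+ suc m) (H c r) ⟩
    + suc m * + (m !) * H c r
      ≡⟨ *-congʳ (H c r) (sym (pos-* (suc m) (m !))) ⟩
    + (suc m !) * H c r ∎
    where
    summand : (V × V) × List (V × V) → ℤ
    summand (e , E) = moment E (cover c e) r + ⟦ new c e ⟧ * (+ r * moment E (cover c e) (pred r))
    lemma : ∀ x y z → x * (y * z) ≡ y * x * z
    lemma = solve-∀
    step : ∀ e E → (∀ r → moment E (cover c e) r * falling N r ≡ + (m !) * H (cover c e) r) →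
      summand (e , E) * falling N r ≡ + (m !) * weight c r e
    step e E ih = begin
      (M + i * (+ r * M′)) * falling N r
        ≡⟨ expand M M′ i (+ r) (falling N r) ⟩
      M * falling N r + i * (M′ * (+ r * falling N r))
        ≡⟨ cong (λ z → M * falling N r + i * (M′ * z)) (falling-r N r) ⟩
      M * falling N r + i * (M′ * (+ r * (falling N (pred r) * (N - + pred r))))
        ≡⟨ regroup (M * falling N r) M′ i (+ r) (falling N (pred r)) (N - + pred r) ⟩
      M * falling N r + i * (+ r * ((N - + pred r) * (M′ * falling N (pred r))))
        ≡⟨ cong₂ (λ x y → x + i * (+ r * ((N - + pred r) * y))) (ih r) (ih (pred r)) ⟩
      + (m !) * h + i * (+ r * ((N - + pred r) * (+ (m !) * h′)))
        ≡⟨ factor (+ (m !)) h h′ i (+ r) (N - + pred r) ⟩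
      + (m !) * (h + i * (+ r * ((N - + pred r) * h′))) ∎
      where
      M M′ i h h′ : ℤ
      M  = moment E (cover c e) r
      M′ = moment E (cover c e) (pred r)
      i  = ⟦ new c e ⟧
      h  = H (cover c e) r
      h′ = H (cover c e) (pred r)
      expand : ∀ M M′ i r n → (M + i * (r * M′)) * n ≡ M * n + i * (M′ * (r * n))
      expand = solve-∀
      regroup : ∀ x M′ i r n k → x + i * (M′ * (r * (n * k))) ≡ x + i * (r * (k * (M′ * n)))
      regroup = solve-∀
      factor : ∀ f h h′ i r k → f * h + i * (r * (k * (f * h′))) ≡ f * (h + i * (r * (k * h′)))
      factor = solve-∀

  moment-K : .{{_ : NonZero t}} → ∀ r →
    moment Ks,t (λ _ → false) r * falling N r ≡ + (length Ks,t !) * (falling (+ s) r * falling (+ t) r)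
  moment-K r = trans (moment-pending (length Ks,t) Ks,t (λ _ → false) refl (λ _ _ → refl) r)
    (cong₂ (λ a b → + (length Ks,t !) * (falling a r * falling b r)) (uncovered-∅ s) (uncovered-∅ t))

-- Components of the forest

bool-ext : ∀ {x y} → (T x → T y) → (T y → T x) → x ≡ y
bool-ext {true}  {true}  f g = refl
bool-ext {true}  {false} f g with () ← f _
bool-ext {false} {true}  f g with () ← g _
bool-ext {false} {false} f g = refl

==-sound : ∀ {i j : Fin m} → T (i == j) → i ≡ j
==-sound {i = i} {j} t = ==⇒≡ i j (Equivalence.to T-≡ t)

==-complete : ∀ {i j : Fin m} → i ≡ j → T (i == j)
==-complete {i = i} refl = Equivalence.from T-≡ (==-refl i)

any-cong : ∀ {A : Set} {p q : A → Bool} xs → (∀ x → p x ≡ q x) → any p xs ≡ any q xs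
any-cong []       h = refl
any-cong (x ∷ xs) h = cong₂ _∨_ (h x) (any-cong xs h)

any-allFin-suc : ∀ m (p : Fin (suc m) → Bool) → any p (allFin (suc m)) ≡ p zero ∨ any (p ∘ suc) (allFin m)
any-allFin-suc m p = cong (p zero ∨_) (trans
  (cong (any p) (sym (map-tabulate id suc)))
  (cong or (sym (map-∘ (allFin m)))))

-- The leastness test of `components`, with connectedness replaced by an arbitrary predicate.
earlier : (Fin m → Bool) → Fin m → Bool
earlier {m} p v = any (λ u → does (suc (toℕ u) ℕ.≤? toℕ v) ∧ p u) (allFin m)

earlier-zero : ∀ (p : Fin (suc m) → Bool) → earlier p zero ≡ false
earlier-zero {m} p = trans (any-allFin-suc m (λ u → does (suc (toℕ u) ℕ.≤? 0) ∧ p u)) (none (allFin m))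
  where
  none : ∀ {A : Set} (xs : List A) → any (λ _ → false) xs ≡ false
  none []       = refl
  none (x ∷ xs) = none xs

earlier-suc : ∀ (p : Fin (suc m) → Bool) v → earlier p (suc v) ≡ p zero ∨ earlier (p ∘ suc) v
earlier-suc {m} p v = any-allFin-suc m (λ u → does (suc (toℕ u) ℕ.≤? suc (toℕ v)) ∧ p u)

∑-first : ∀ m (p : Fin m → Bool) →
  ∑ (allFin m) (λ v → ⟦ p v ∧ not (earlier p v) ⟧) ≡ ⟦ any p (allFin m) ⟧
∑-first zero    p = refl
∑-first (suc m) p = trans
  (trans (∑-allFin-suc m (λ v → ⟦ p v ∧ not (earlier p v) ⟧))
    (cong₂ _+_ (cong (λ b → ⟦ p zero ∧ not b ⟧) (earlier-zero p))
      (∑-cong (allFin m) λ v → cong (λ b → ⟦ p (suc v) ∧ not b ⟧) (earlier-suc p v))))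
  (trans (cases (p zero)) (cong ⟦_⟧ (sym (any-allFin-suc m p))))
  where
  cases : ∀ b → ⟦ b ∧ true ⟧ + ∑ (allFin m) (λ v → ⟦ p (suc v) ∧ not (b ∨ earlier (p ∘ suc) v) ⟧)
    ≡ ⟦ b ∨ any (p ∘ suc) (allFin m) ⟧
  cases true  = +-congˡ 1ℤ (∑-0 (allFin m) λ v → zeroʳ (p (suc v)))
    where
    zeroʳ : ∀ x → ⟦ x ∧ false ⟧ ≡ 0ℤ
    zeroʳ true  = refl
    zeroʳ false = refl
  cases false = trans (+-identityˡ (∑ (allFin m) λ v → ⟦ p (suc v) ∧ not (earlier (p ∘ suc) v) ⟧)) (∑-first m (p ∘ suc))

fixed : (Fin m → Fin m) → ℤ
fixed {m} ℓ = ∑ (allFin m) (λ w → ⟦ ℓ w == w ⟧)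

-- Every class of an idempotent labelling has one least element and one fixed point.
∑-least : ∀ (ℓ : Fin m → Fin m) → (∀ x → ℓ (ℓ x) ≡ ℓ x) →
  ∑ (allFin m) (λ v → ⟦ not (earlier (λ u → ℓ u == ℓ v) v) ⟧) ≡ fixed ℓ
∑-least {m} ℓ idem = begin
  ∑ (allFin m) (λ v → ⟦ not (earlier (λ u → ℓ u == ℓ v) v) ⟧)
    ≡⟨ ∑-cong (allFin m) (λ v → sym (∑-δ m (ℓ v) (λ w → ⟦ not (earlier (λ u → ℓ u == w) v) ⟧))) ⟩
  ∑ (allFin m) (λ v → ∑ (allFin m) (λ w → ⟦ w == ℓ v ⟧ * ⟦ not (earlier (λ u → ℓ u == w) v) ⟧))
    ≡⟨ ∑-swap (allFin m) (allFin m) (λ v w → ⟦ w == ℓ v ⟧ * ⟦ not (earlier (λ u → ℓ u == w) v) ⟧) ⟩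
  ∑ (allFin m) (λ w → ∑ (allFin m) (λ v → ⟦ w == ℓ v ⟧ * ⟦ not (earlier (λ u → ℓ u == w) v) ⟧))
    ≡⟨ ∑-cong (allFin m) (λ w → trans
         (∑-cong (allFin m) λ v → trans (*-∧ (w == ℓ v) (not (earlier (λ u → ℓ u == w) v)))
           (cong (λ b → ⟦ b ∧ not (earlier (λ u → ℓ u == w) v) ⟧) (==-sym w (ℓ v))))
         (trans (∑-first m (λ v → ℓ v == w)) (cong ⟦_⟧ (image w)))) ⟩
  fixed ℓ ∎
  where
  *-∧ : ∀ x y → ⟦ x ⟧ * ⟦ y ⟧ ≡ ⟦ x ∧ y ⟧
  *-∧ true  true  = refl
  *-∧ true  false = refl
  *-∧ false true  = refl
  *-∧ false false = refl
  ==-sym : ∀ (i j : Fin m) → (i == j) ≡ (j == i)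
  ==-sym i j = bool-ext (λ h → ==-complete (sym (==-sound {i = i} h))) (λ h → ==-complete (sym (==-sound {i = j} h)))
  -- By idempotence the labels in use are exactly the fixed points.
  image : ∀ w → any (λ v → ℓ v == w) (allFin m) ≡ (ℓ w == w)
  image w = bool-ext
    (λ h → let v , _ , ℓv=w = find (any⁻ (λ v → ℓ v == w) (allFin m) h) in
      ==-complete (trans (cong ℓ (sym (==-sound ℓv=w))) (trans (idem v) (==-sound ℓv=w))))
    (λ h → any⁺ (λ v → ℓ v == w) (lose (∈-allFin w) h))

-- Walks and component labellings

Edges : ℕ → Set
Edges m = List (Fin m × Fin m)

Adjacent : Edges m → Fin m → Fin m → Set
Adjacent S x y = (x , y) ∈ S ⊎ (y , x) ∈ S

-- Walks of length at most i.
data Walk (S : Edges m) : ℕ → Fin m → Fin m → Set where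
  nil  : ∀ {i x} → Walk S i x x
  snoc : ∀ {i x y z} → Walk S i x y → Adjacent S y z → Walk S (suc i) x z

Walk-cons : ∀ {S : Edges m} {i x y z} → Adjacent S x y → Walk S i y z → Walk S (suc i) x z
Walk-cons a nil        = snoc nil a
Walk-cons a (snoc w b) = snoc (Walk-cons a w) b

Walk-mono : ∀ {S S′ : Edges m} {i j x y} → (∀ {e} → e ∈ S → e ∈ S′) → i ≤ j → Walk S i x y → Walk S′ j x y
Walk-mono S⊆S′ i≤j       nil               = nil
Walk-mono S⊆S′ (s≤s i≤j) (snoc w (inj₁ e)) = snoc (Walk-mono S⊆S′ i≤j w) (inj₁ (S⊆S′ e))
Walk-mono S⊆S′ (s≤s i≤j) (snoc w (inj₂ e)) = snoc (Walk-mono S⊆S′ i≤j w) (inj₂ (S⊆S′ e))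

T-∨ˡ : ∀ {x y} → T x → T (x ∨ y)
T-∨ˡ h = Equivalence.from T-∨ (inj₁ h)

T-∨ʳ : ∀ {x y} → T y → T (x ∨ y)
T-∨ʳ h = Equivalence.from T-∨ (inj₂ h)

T-∧⁺ : ∀ {x y} → T x → T y → T (x ∧ y)
T-∧⁺ h k = Equivalence.from T-∧ (h , k)

reachWithin-complete : ∀ {S : Edges m} {i x y} → Walk S i x y → T (reachWithin S i x y)
reachWithin-complete {i = zero} {x} nil = ==-complete {i = x} refl
reachWithin-complete {S = S} {i = suc i} {x} nil = T-∨ˡ (reachWithin-complete {S = S} {i} {x} nil)
reachWithin-complete {S = S} (snoc {i} {x} {y} {z} w (inj₁ e)) =
  T-∨ʳ {reachWithin S i x z} (any⁺ _ (lose e (T-∨ˡ (T-∧⁺ (reachWithin-complete w) (==-complete {i = z} refl)))))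
reachWithin-complete {S = S} (snoc {i} {x} {y} {z} w (inj₂ e)) =
  T-∨ʳ {reachWithin S i x z} (any⁺ _ (lose e (T-∨ʳ {reachWithin S i x z ∧ (z == y)} (T-∧⁺ (reachWithin-complete w) (==-complete {i = z} refl)))))

-- The search never leaves a fibre of a function that is constant along edges, so no walk has to be
-- extracted from the Boolean.
reachWithin-sound : ∀ {A : Set} {S : Edges m} (ℓ : Fin m → A) → (∀ {a b} → (a , b) ∈ S → ℓ a ≡ ℓ b) →
  ∀ i {x y} → T (reachWithin S i x y) → ℓ x ≡ ℓ y
reachWithin-sound ℓ sound zero    h = cong ℓ (==-sound h)
reachWithin-sound {S = S} ℓ sound (suc i) {x} {y} h with Equivalence.to (T-∨ {reachWithin S i x y}) h
... | inj₁ r = reachWithin-sound ℓ sound i r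
... | inj₂ r with find (any⁻ _ S r)
...   | (a , b) , e , t with Equivalence.to (T-∨ {reachWithin S i x a ∧ (y == b)}) t
...     | inj₁ t₁ = let r′ , y=b = Equivalence.to (T-∧ {reachWithin S i x a}) t₁ in
  trans (reachWithin-sound ℓ sound i r′) (trans (sound e) (cong ℓ (sym (==-sound y=b))))
...     | inj₂ t₂ = let r′ , y=a = Equivalence.to (T-∧ {reachWithin S i x b}) t₂ in
  trans (reachWithin-sound ℓ sound i r′) (trans (sym (sound e)) (cong ℓ (sym (==-sound y=a))))

-- `ℓ` picks a representative in each component of the forest `S` built so far, and `fresh` says
-- that uncovered vertices are isolated. Walks are bounded by `length S`, a bound that grows by one
-- with each added edge; `size`, the count of components plus edges in a forest, gives
-- `length S ≤ m`, so they fit into the depth searched by `connected`.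
record Labelling {m} (S : Edges m) (c : Fin m → Bool) (ℓ : Fin m → Fin m) : Set where
  field
    idem     : ∀ x → ℓ (ℓ x) ≡ ℓ x
    fresh    : ∀ {x w} → c w ≡ false → ℓ x ≡ ℓ w → x ≡ w
    sound    : ∀ {a b} → (a , b) ∈ S → ℓ a ≡ ℓ b
    complete : ∀ {x y} → ℓ x ≡ ℓ y → Walk S (length S) x y
    size     : fixed ℓ + + length S ≡ + m

  ℓ-fresh : ∀ {w} → c w ≡ false → ℓ w ≡ w
  ℓ-fresh {w} cw = fresh cw (idem w)

fixed-ℕ : ∀ (ℓ : Fin m → Fin m) → fixed ℓ ≡ + length (filter (λ w → ℓ w ≟ᶠ w) (allFin m))
fixed-ℕ {m} ℓ = sym (length-filter-∑ (λ w → ℓ w ≟ᶠ w) (allFin m))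

components-fixed : ∀ {S : Edges m} {c ℓ} → Labelling S c ℓ → + components m S ≡ fixed ℓ
components-fixed {m} {S} {c} {ℓ} L = begin
  + components m S
    ≡⟨ length-filter-∑ _ (allFin m) ⟩
  ∑ (allFin m) (λ v → ⟦ not (earlier (λ u → connected S u v) v) ⟧)
    ≡⟨ ∑-cong (allFin m) (λ v → cong (⟦_⟧ ∘ not) (any-cong (allFin m) λ u → cong (_ ∧_) (connected-label u v))) ⟩
  ∑ (allFin m) (λ v → ⟦ not (earlier (λ u → ℓ u == ℓ v) v) ⟧)
    ≡⟨ ∑-least ℓ idem ⟩
  fixed ℓ ∎
  where
  open Labelling L
  |S|≤n : length S ≤ m
  |S|≤n = subst (length S ≤_) (+-injective (trans (cong (λ z → z + + length S) (sym (fixed-ℕ ℓ))) size))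
    (ℕ.m≤n+m (length S) _)
  connected-label : ∀ u v → connected S u v ≡ (ℓ u == ℓ v)
  connected-label u v = bool-ext
    (λ r → ==-complete (reachWithin-sound ℓ sound m r))
    (λ h → reachWithin-complete (Walk-mono id |S|≤n (complete (==-sound h))))

-- An uncovered vertex is alone in its class, so joining it to another class changes a single label.
relabel : Fin m → Fin m → (Fin m → Fin m) → Fin m → Fin m
relabel u l ℓ w = if w == u then l else ℓ w

relabel-≡ : ∀ (u l : Fin m) ℓ → relabel u l ℓ u ≡ l
relabel-≡ u l ℓ rewrite ==-refl u = refl

relabel-≢ : ∀ {u w : Fin m} l ℓ → w ≢ u → relabel u l ℓ w ≡ ℓ w
relabel-≢ l ℓ w≢u rewrite ≢⇒== w≢u = refl

-- Only `fresh` mentions the covered set, and covering more vertices weakens it.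
Labelling-cover : ∀ {S : Edges m} {c c′ ℓ} → (∀ w → c′ w ≡ false → c w ≡ false) →
  Labelling S c ℓ → Labelling S c′ ℓ
Labelling-cover h L = record
  { idem = idem ; fresh = λ {x} {w} c′w → fresh (h w c′w) ; sound = sound ; complete = complete ; size = size }
  where open Labelling L

module _ {S : Edges m} {c ℓ} (L : Labelling S c ℓ) {u v : Fin m} (cu : c u ≡ false) (u≢v : u ≢ v) where
  open Labelling L

  private
    ℓ′ : Fin m → Fin m
    ℓ′ = relabel u (ℓ v) ℓ

    ℓ≢u : ∀ {x} → x ≢ u → ℓ x ≢ u
    ℓ≢u x≢u ℓx≡u = x≢u (fresh cu (trans ℓx≡u (sym (ℓ-fresh cu))))

    ℓ′-u : ℓ′ u ≡ ℓ v
    ℓ′-u = relabel-≡ u (ℓ v) ℓ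

    ℓ′-≢ : ∀ {w} → w ≢ u → ℓ′ w ≡ ℓ w
    ℓ′-≢ = relabel-≢ (ℓ v) ℓ

    ℓ′-cong : ∀ {a b} → ℓ a ≡ ℓ b → ℓ′ a ≡ ℓ′ b
    ℓ′-cong {a} {b} eq with a ≟ᶠ u | b ≟ᶠ u
    ... | yes refl | yes refl = refl
    ... | yes refl | no  b≢u  = contradiction (fresh cu (sym eq)) b≢u
    ... | no  a≢u  | yes refl = contradiction (fresh cu eq) a≢u
    ... | no  a≢u  | no  b≢u  = eq

  -- The vertex `u` was its own label and now carries `ℓ v`, which differs from `u` because `u` was
  -- alone in its class.
  fixed-relabel : fixed ℓ′ ≡ fixed ℓ - 1ℤ
  fixed-relabel = begin
    fixed ℓ′
      ≡⟨ ∑-cong (allFin m) pointwise ⟩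
    ∑ (allFin m) (λ w → ⟦ ℓ w == w ⟧ - ⟦ w == u ⟧ * 1ℤ)
      ≡⟨ ∑-minus (allFin m) (λ w → ⟦ ℓ w == w ⟧) (λ w → ⟦ w == u ⟧ * 1ℤ) ⟩
    fixed ℓ - ∑ (allFin m) (λ w → ⟦ w == u ⟧ * 1ℤ)
      ≡⟨ cong (λ z → fixed ℓ - z) (∑-δ m u (λ _ → 1ℤ)) ⟩
    fixed ℓ - 1ℤ ∎
    where
    pointwise : ∀ w → ⟦ ℓ′ w == w ⟧ ≡ ⟦ ℓ w == w ⟧ - ⟦ w == u ⟧ * 1ℤ
    pointwise w with w ≟ᶠ u
    ... | yes refl rewrite ≢⇒== (ℓ≢u (u≢v ∘ sym)) | ℓ-fresh cu | ==-refl w = refl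
    ... | no  w≢u  = sym (+-identityʳ ⟦ ℓ w == w ⟧)

  -- Hanging an uncovered, hence isolated, vertex u on v costs one component
  -- and lengthens walks by at most one.
  Labelling-pendant : ∀ {c′ e} → (∀ w → c′ w ≡ false → c w ≡ false × w ≢ u × w ≢ v) →
    e ≡ (u , v) ⊎ e ≡ (v , u) → Labelling (S ∷ʳ e) c′ ℓ′
  Labelling-pendant {c′} {e} c′-false e≡ = record
    { idem     = idem′
    ; fresh    = fresh′
    ; sound    = sound′
    ; complete = λ {x} {y} eq → subst (λ i → Walk (S ∷ʳ e) i x y) (sym |S′|) (complete′ eq)
    ; size     = trans (cong₂ (λ x y → x + + y) fixed-relabel |S′|) (trans (lemma (fixed ℓ) (+ length S)) size)
    }
    where
    |S′| : length (S ∷ʳ e) ≡ suc (length S)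
    |S′| = trans (length-++ S) (ℕ.+-comm (length S) 1)
    lemma : ∀ x y → x - 1ℤ + (1ℤ + y) ≡ x + y
    lemma = solve-∀
    idem′ : ∀ x → ℓ′ (ℓ′ x) ≡ ℓ′ x
    idem′ x with x ≟ᶠ u
    ... | yes refl = trans (ℓ′-≢ (ℓ≢u (u≢v ∘ sym))) (idem v)
    ... | no  x≢u  = trans (ℓ′-≢ (ℓ≢u x≢u)) (idem x)
    fresh′ : ∀ {x w} → c′ w ≡ false → ℓ′ x ≡ ℓ′ w → x ≡ w
    fresh′ {x} {w} c′w eq with c′-false w c′w
    ... | cw , w≢u , w≢v with x ≟ᶠ u
    ...   | yes refl = contradiction (sym (fresh cw (trans eq (ℓ′-≢ w≢u)))) w≢v
    ...   | no  x≢u  = fresh cw (trans eq (ℓ′-≢ w≢u))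
    adjacent : e ≡ (u , v) ⊎ e ≡ (v , u) → Adjacent (S ∷ʳ e) u v
    adjacent (inj₁ refl) = inj₁ (∈-++⁺ʳ S (here refl))
    adjacent (inj₂ refl) = inj₂ (∈-++⁺ʳ S (here refl))
    ℓ′u≡ℓ′v : ℓ′ u ≡ ℓ′ v
    ℓ′u≡ℓ′v = trans ℓ′-u (sym (ℓ′-≢ (u≢v ∘ sym)))
    sound-e : ∀ {a b} → e ≡ (u , v) ⊎ e ≡ (v , u) → (a , b) ≡ e → ℓ′ a ≡ ℓ′ b
    sound-e (inj₁ refl) refl = ℓ′u≡ℓ′v
    sound-e (inj₂ refl) refl = sym ℓ′u≡ℓ′v
    sound′ : ∀ {a b} → (a , b) ∈ S ∷ʳ e → ℓ′ a ≡ ℓ′ b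
    sound′ ab∈ with ∈-++⁻ S ab∈
    ... | inj₁ ab∈S      = ℓ′-cong (sound ab∈S)
    ... | inj₂ (here ab) = sound-e e≡ ab
    complete′ : ∀ {x y} → ℓ′ x ≡ ℓ′ y → Walk (S ∷ʳ e) (suc (length S)) x y
    complete′ {x} {y} eq with x ≟ᶠ u | y ≟ᶠ u
    ... | yes refl | yes refl = nil
    -- The new label of `u` is that of `v`, so an old walk at `v` is extended by the new edge; this
    -- is the one extra step in the bound.
    ... | yes refl | no  y≢u  = Walk-cons (adjacent e≡) (Walk-mono ∈-++⁺ˡ ℕ.≤-refl (complete eq))
    ... | no  x≢u  | yes refl = snoc (Walk-mono ∈-++⁺ˡ ℕ.≤-refl (complete eq)) (Sum.swap (adjacent e≡))
    ... | no  x≢u  | no  y≢u  = Walk-mono ∈-++⁺ˡ (ℕ.n≤1+n (length S)) (complete eq)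

-- Counting components along the process

coverAll : (Fin m → Bool) → Edges m → Fin m → Bool
coverAll = foldl cover

uncovered-cover : ∀ (c : Fin m → Bool) {u v} → u ≢ v →
  uncovered (cover c (u , v)) ≡ uncovered c - ⟦ not (c u) ⟧ - ⟦ not (c v) ⟧
uncovered-cover c {u} {v} u≢v = begin
  uncovered (cover c (u , v))
    ≡⟨ uncovered-cong (λ w → sym (∨-assoc (c w) (w == u) (w == v))) ⟩
  uncovered (λ w → (c w ∨ (w == u)) ∨ (w == v))
    ≡⟨ uncovered-∨ (λ w → c w ∨ (w == u)) v ⟩
  uncovered (λ w → c w ∨ (w == u)) - ⟦ not (c v ∨ (v == u)) ⟧
    ≡⟨ cong₂ (λ x y → x - ⟦ not y ⟧) (uncovered-∨ c u)
         (trans (cong (c v ∨_) (≢⇒== (u≢v ∘ sym))) (∨-identityʳ (c v))) ⟩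
  uncovered c - ⟦ not (c u) ⟧ - ⟦ not (c v) ⟧ ∎

cover-false : ∀ (c : Fin m → Bool) {u v} w → cover c (u , v) w ≡ false → c w ≡ false × w ≢ u × w ≢ v
cover-false c {u} {v} w h with c w | w ≟ᶠ u | w ≟ᶠ v | h
... | false | no w≢u | no w≢v | _ = refl , w≢u , w≢v

fixed-id : fixed {m} id ≡ + m
fixed-id {m} = trans (∑-cong (allFin m) λ w → cong ⟦_⟧ (==-refl w))
  (trans (∑-const (allFin m) 1ℤ) (trans (*-identityʳ (+ length (allFin m))) (cong +_ (length-allFin m))))

Labelling-∅ : Labelling {m} [] (λ _ → false) id
Labelling-∅ {m} = record
  { idem     = λ _ → refl
  ; fresh    = λ _ → id
  ; sound    = λ ()
  ; complete = λ { refl → nil }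
  ; size     = trans (+-identityʳ (fixed {m} id)) fixed-id
  }

-- The covered fixed points of ℓ, fixed ℓ - uncovered c in number, increase by one
-- exactly when an edge has both ends uncovered.
components-process : ∀ {S : Edges m} {c ℓ} → Labelling S c ℓ → ∀ es → All (λ (u , v) → u ≢ v) es →
  (∀ w → coverAll c es w ≡ true) →
  + components m (S ++ process c es) ≡ fixed ℓ - uncovered c + + starts c es
components-process {m} {S} {c} {ℓ} L [] [] covered = begin
  + components m (S ++ [])
    ≡⟨ cong (λ S → + components m S) (++-identityʳ S) ⟩
  + components m S
    ≡⟨ components-fixed L ⟩
  fixed ℓ
    ≡⟨ lemma (fixed ℓ) ⟩
  fixed ℓ - 0ℤ + 0ℤ
    ≡⟨ cong (λ z → fixed ℓ - z + 0ℤ) (sym (∑-0 (allFin m) λ w → cong (⟦_⟧ ∘ not) (covered w))) ⟩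
  fixed ℓ - uncovered c + 0ℤ ∎
  where
  lemma : ∀ x → x ≡ x - 0ℤ + 0ℤ
  lemma = solve-∀
components-process {m} {S} {c} {ℓ} L ((u , v) ∷ es) (u≢v ∷ loopless) covered
  with c u in cu | c v in cv | uncovered-cover c u≢v
... | true | true | cover≡ = trans
  (components-process (Labelling-cover (λ w → proj₁ ∘ cover-false c w) L) es loopless covered)
  (cong (λ z → fixed ℓ - z + + starts (cover c (u , v)) es) (trans cover≡ (lemma (uncovered c))))
  where
  lemma : ∀ x → x - 0ℤ - 0ℤ ≡ x
  lemma = solve-∀
... | true | false | cover≡ = begin
  + components m (S ++ (u , v) ∷ process (cover c (u , v)) es)
    ≡⟨ cong (λ S → + components m S) (sym (++-assoc S ((u , v) ∷ []) (process (cover c (u , v)) es))) ⟩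
  + components m ((S ∷ʳ (u , v)) ++ process (cover c (u , v)) es)
    ≡⟨ components-process (Labelling-pendant L cv (u≢v ∘ sym) (λ w h → let cw , w≢u , w≢v = cover-false c w h in cw , w≢v , w≢u) (inj₂ refl)) es loopless covered ⟩
  fixed (relabel v (ℓ u) ℓ) - uncovered (cover c (u , v)) + + starts (cover c (u , v)) es
    ≡⟨ cong₂ (λ x y → x - y + + starts (cover c (u , v)) es) (fixed-relabel L cv (u≢v ∘ sym)) cover≡ ⟩
  fixed ℓ - 1ℤ - (uncovered c - 0ℤ - 1ℤ) + + starts (cover c (u , v)) es
    ≡⟨ lemma (fixed ℓ) (uncovered c) (+ starts (cover c (u , v)) es) ⟩
  fixed ℓ - uncovered c + + starts (cover c (u , v)) es ∎
  where
  lemma : ∀ x y z → x - 1ℤ - (y - 0ℤ - 1ℤ) + z ≡ x - y + z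
  lemma = solve-∀
-- Whether or not `v` is covered, `u` is hung on `v` and one fixed point is lost. If `v` is
-- uncovered too, `uncovered` drops by two, and the difference is the unit counted by `starts`.
... | false | cv′ | cover≡ = begin
  + components m (S ++ (u , v) ∷ process (cover c (u , v)) es)
    ≡⟨ cong (λ S → + components m S) (sym (++-assoc S ((u , v) ∷ []) (process (cover c (u , v)) es))) ⟩
  + components m ((S ∷ʳ (u , v)) ++ process (cover c (u , v)) es)
    ≡⟨ components-process (Labelling-pendant L cu u≢v (cover-false c) (inj₁ refl)) es loopless covered ⟩
  fixed (relabel u (ℓ v) ℓ) - uncovered (cover c (u , v)) + + starts (cover c (u , v)) es
    ≡⟨ cong₂ (λ x y → x - y + + starts (cover c (u , v)) es) (fixed-relabel L cu u≢v) cover≡ ⟩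
  fixed ℓ - 1ℤ - (uncovered c - 1ℤ - ⟦ not cv′ ⟧) + + starts (cover c (u , v)) es
    ≡⟨ count cv′ ⟩
  fixed ℓ - uncovered c + + (if not cv′ then suc (starts (cover c (u , v)) es) else starts (cover c (u , v)) es) ∎
  where
  count : ∀ b → fixed ℓ - 1ℤ - (uncovered c - 1ℤ - ⟦ not b ⟧) + + starts (cover c (u , v)) es
    ≡ fixed ℓ - uncovered c + + (if not b then suc (starts (cover c (u , v)) es) else starts (cover c (u , v)) es)
  count true  = lemma (fixed ℓ) (uncovered c) (+ starts (cover c (u , v)) es)
    where
    lemma : ∀ x y z → x - 1ℤ - (y - 1ℤ - 0ℤ) + z ≡ x - y + z
    lemma = solve-∀
  count false = lemma (fixed ℓ) (uncovered c) (+ starts (cover c (u , v)) es)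
    where
    lemma : ∀ x y z → x - 1ℤ - (y - 1ℤ - 1ℤ) + z ≡ x - y + (1ℤ + z)
    lemma = solve-∀

components-starts : ∀ es → All (λ (u , v) → u ≢ v) es → (∀ w → coverAll {m} (λ _ → false) es w ≡ true) →
  components m (process (λ _ → false) es) ≡ starts (λ _ → false) es
components-starts {m} es loopless covered = +-injective (begin
  + components m (process (λ _ → false) es)
    ≡⟨ components-process Labelling-∅ es loopless covered ⟩
  fixed {m} id - uncovered {m} (λ _ → false) + + starts (λ _ → false) es
    ≡⟨ cong₂ (λ x y → x - y + + starts (λ _ → false) es) fixed-id (uncovered-∅ m) ⟩
  + m - + m + + starts (λ _ → false) es
    ≡⟨ lemma (+ m) (+ starts (λ _ → false) es) ⟩
  + starts (λ _ → false) es ∎)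
  where
  lemma : ∀ x y → x - x + y ≡ y
  lemma = solve-∀

-- Orderings of the edges of K_{s,t}

insertions-↭ : ∀ (x : A) ys {τ} → τ ∈ insertions x ys → τ ↭ x ∷ ys
insertions-↭ x []       (here refl) = ↭-refl
insertions-↭ x (y ∷ ys) (here refl) = ↭-refl
insertions-↭ x (y ∷ ys) (there τ∈) with ∈-map⁻ (y ∷_) τ∈
... | τ , τ∈′ , refl = ↭-trans (prep y (insertions-↭ x ys τ∈′)) (swap y x ↭-refl)

orderings-↭ : ∀ (xs : List A) {σ} → σ ∈ orderings xs → σ ↭ xs
orderings-↭ []       (here refl) = ↭-refl
orderings-↭ (x ∷ xs) σ∈ with find (∈-concatMap⁻ (insertions x) {xs = orderings xs} σ∈)
... | τ , τ∈ , σ∈′ = ↭-trans (insertions-↭ x τ σ∈′) (prep x (orderings-↭ xs τ∈))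

coverAll-mono : ∀ (c : Fin m → Bool) es w → c w ≡ true → coverAll c es w ≡ true
coverAll-mono c []       w cw = cw
coverAll-mono c (e ∷ es) w cw = coverAll-mono (cover c e) es w (cong (_∨ _) cw)

coverAll-∈ : ∀ (c : Fin m → Bool) es {u v} w → (u , v) ∈ es → w ≡ u ⊎ w ≡ v → coverAll c es w ≡ true
coverAll-∈ c ((u , v) ∷ es) w (here refl) (inj₁ refl) =
  coverAll-mono (cover c (u , v)) es w (trans (cong (λ b → c w ∨ b ∨ (w == v)) (==-refl w)) (∨-zeroʳ (c w)))
coverAll-∈ c ((u , v) ∷ es) w (here refl) (inj₂ refl) =
  coverAll-mono (cover c (u , v)) es w
    (trans (cong (λ b → c w ∨ (w == u) ∨ b) (==-refl w)) (trans (cong (c w ∨_) (∨-zeroʳ (w == u))) (∨-zeroʳ (c w))))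
coverAll-∈ c (e ∷ es) w (there e∈) w∈e = coverAll-∈ (cover c e) es w e∈ w∈e

module _ (s t : ℕ) where
  open Bipartite s t

  IsEdge : V × V → Set
  IsEdge e = ∃₂ λ i j → e ≡ (i ↑ˡ t , s ↑ʳ j)

  ∈Ks,t : ∀ i j → (i ↑ˡ t , s ↑ʳ j) ∈ Ks,t
  ∈Ks,t i j = ∈-concatMap⁺ (λ i → map (λ j → i ↑ˡ t , s ↑ʳ j) (allFin t))
    (lose (∈-allFin i) (∈-map⁺ (λ j → i ↑ˡ t , s ↑ʳ j) (∈-allFin j)))

  ∈Ks,t⁻ : ∀ {e} → e ∈ Ks,t → IsEdge e
  ∈Ks,t⁻ e∈ with find (∈-concatMap⁻ (λ i → map (λ j → i ↑ˡ t , s ↑ʳ j) (allFin t)) {xs = allFin s} e∈)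
  ... | i , _ , e∈′ with ∈-map⁻ (λ j → i ↑ˡ t , s ↑ʳ j) e∈′
  ...   | j , _ , refl = i , j , refl

  ordering-IsEdge : ∀ {σ} → σ ∈ orderings Ks,t → All IsEdge σ
  ordering-IsEdge σ∈ = All.tabulate (∈Ks,t⁻ ∘ ∈-resp-↭ (orderings-↭ Ks,t σ∈))

  ordering-covers : .{{_ : NonZero s}} → .{{_ : NonZero t}} → ∀ {σ} → σ ∈ orderings Ks,t →
    ∀ w → coverAll (λ _ → false) σ w ≡ true
  ordering-covers {σ} σ∈ w with splitAt s w in eq
  -- Any edge at `w` will do; the opposite part is nonempty, so its vertex 0 serves as the other
  -- end.
  ... | inj₁ i = coverAll-∈ (λ _ → false) σ w
    (∈-resp-↭ (↭-sym (orderings-↭ Ks,t σ∈)) (∈Ks,t i (fromℕ< {0} (ℕ.>-nonZero⁻¹ t))))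
    (inj₁ (trans (sym (join-splitAt s t w)) (cong (join s t) eq)))
  ... | inj₂ j = coverAll-∈ (λ _ → false) σ w
    (∈-resp-↭ (↭-sym (orderings-↭ Ks,t σ∈)) (∈Ks,t (fromℕ< {0} (ℕ.>-nonZero⁻¹ s)) j))
    (inj₂ (trans (sym (join-splitAt s t w)) (cong (join s t) eq)))

  components-ordering : .{{_ : NonZero s}} → .{{_ : NonZero t}} → ∀ {σ} → σ ∈ orderings Ks,t →
    components (s ℕ.+ t) (forestOf (K s t) σ) ≡ starts (λ _ → false) σ
  components-ordering {σ} σ∈ = components-starts σ
    (All.map (λ { (i , j , refl) → ↑ˡ≢↑ʳ i j }) (ordering-IsEdge σ∈)) (ordering-covers σ∈)

  -- Each starting edge covers a new vertex of the first part; `k` absorbs the vertices covered by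
  -- other edges or not at all.
  rows-starts : ∀ c es → All IsEdge es → ∃[ k ] rows c ≡ + (starts c es ℕ.+ k)
  rows-starts c []       []                      = _ , sym (length-filter-∑ (λ i → T? (not (c (i ↑ˡ t)))) (allFin s))
  rows-starts c (_ ∷ es) ((i , j , refl) ∷ edges) with rows-starts (cover c (i ↑ˡ t , s ↑ʳ j)) es edges
  ... | k , eq with c (i ↑ˡ t) | c (s ↑ʳ j) | trans (sym eq) (rows-cover c i j)
  ...   | true  | _     | h = k , trans (sym (+-identityʳ (rows c))) (sym h)
  ...   | false | true  | h = suc k , trans (lemma (rows c)) (trans (cong (λ z → 1ℤ + z) (sym h)) (cong +_ (sym (ℕ.+-suc _ k))))
    where
    lemma : ∀ x → x ≡ 1ℤ + (x - 1ℤ)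
    lemma = solve-∀
  ...   | false | false | h = k , trans (lemma (rows c)) (cong (λ z → 1ℤ + z) (sym h))
    where
    lemma : ∀ x → x ≡ 1ℤ + (x - 1ℤ)
    lemma = solve-∀

  starts≤s : ∀ {σ} → σ ∈ orderings Ks,t → starts (λ _ → false) σ ≤ s
  starts≤s {σ} σ∈ = let k , eq = rows-starts (λ _ → false) σ (ordering-IsEdge σ∈) in
    subst (starts (λ _ → false) σ ≤_) (+-injective (trans (sym eq) (uncovered-∅ s))) (ℕ.m≤m+n _ k)

-- The moments of the claimed distribution

binom : ℕ → ℕ → ℤ
binom n k = + (n C k)

pascal : ∀ n k → binom (suc n) (suc k) ≡ binom n k + binom n (suc k)
pascal n k = cong +_ (sym (nCk+nC[k+1]≡[n+1]C[k+1] n k))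

binom-zero : ∀ {n k} → n < k → binom n k ≡ 0ℤ
binom-zero n<k = cong +_ (k>n⇒nCk≡0 n<k)

absorb : ∀ n k → + suc k * binom (suc n) (suc k) ≡ + suc n * binom n k
absorb zero    zero    = refl
absorb zero    (suc k) = trans
  (cong (λ z → + suc (suc k) * z) (binom-zero {1} {suc (suc k)} (s≤s (s≤s z≤n))))
  (trans (*-zeroʳ (+ suc (suc k))) (sym (*-congˡ 1ℤ (binom-zero {0} {suc k} (s≤s z≤n)))))
absorb (suc n) zero    = trans (*-identityˡ (binom (suc (suc n)) 1))
  (trans (cong +_ (nC1≡n (suc (suc n)))) (sym (*-identityʳ (+ suc (suc n)))))
absorb (suc n) (suc k) = begin
  + suc (suc k) * binom (suc (suc n)) (suc (suc k))
    ≡⟨ *-congˡ (+ suc (suc k)) (pascal (suc n) (suc k)) ⟩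
  + suc (suc k) * (x + binom (suc n) (suc (suc k)))
    ≡⟨ lemma₁ (+ suc k) x (binom (suc n) (suc (suc k))) ⟩
  x + (+ suc k * x + + suc (suc k) * binom (suc n) (suc (suc k)))
    ≡⟨ +-congˡ x (cong₂ _+_ (absorb n k) (absorb n (suc k))) ⟩
  x + (+ suc n * binom n k + + suc n * binom n (suc k))
    ≡⟨ +-congˡ x (trans (sym (*-distribˡ-+ (+ suc n) (binom n k) (binom n (suc k)))) (*-congˡ (+ suc n) (sym (pascal n k)))) ⟩
  x + + suc n * x
    ≡⟨ sym (suc-* (+ suc n) x) ⟩
  + suc (suc n) * x ∎
  where
  x : ℤ
  x = binom (suc n) (suc k)
  lemma₁ : ∀ k x y → (1ℤ + k) * (x + y) ≡ x + (k * x + (1ℤ + k) * y)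
  lemma₁ = solve-∀

absorb-top : ∀ n k → + suc n * binom n k ≡ binom (suc n) k * (+ suc n - + k)
absorb-top n zero    = lemma (+ suc n)
  where
  lemma : ∀ x → x * 1ℤ ≡ 1ℤ * (x - 0ℤ)
  lemma = solve-∀
absorb-top n (suc k) = begin
  + suc n * y
    ≡⟨ lemma₁ (+ suc n) x y ⟩
  + suc n * (x + y) - + suc n * x
    ≡⟨ cong₂ (λ u v → + suc n * u - v) (sym (pascal n k)) (sym (absorb n k)) ⟩
  + suc n * binom (suc n) (suc k) - + suc k * binom (suc n) (suc k)
    ≡⟨ lemma₂ (+ suc n) (+ suc k) (binom (suc n) (suc k)) ⟩
  binom (suc n) (suc k) * (+ suc n - + suc k) ∎
  where
  x y : ℤ
  x = binom n k
  y = binom n (suc k)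
  lemma₁ : ∀ n x y → n * y ≡ n * (x + y) - n * x
  lemma₁ = solve-∀
  lemma₂ : ∀ n k z → n * z - k * z ≡ z * (n - k)
  lemma₂ = solve-∀

-- `absorb` iterated r times; indices of the form r + m and r + j avoid truncated subtraction.
binom-falling : ∀ r m j → binom (r ℕ.+ m) (r ℕ.+ j) * falling (+ (r ℕ.+ j)) r ≡ falling (+ (r ℕ.+ m)) r * binom m j
binom-falling zero    m j = *-comm (binom m j) 1ℤ
binom-falling (suc r) m j = begin
  binom (suc (r ℕ.+ m)) (suc (r ℕ.+ j)) * (+ suc (r ℕ.+ j) * falling (+ (r ℕ.+ j)) r)
    ≡⟨ lemma (binom (suc (r ℕ.+ m)) (suc (r ℕ.+ j))) (+ suc (r ℕ.+ j)) (falling (+ (r ℕ.+ j)) r) ⟩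
  + suc (r ℕ.+ j) * binom (suc (r ℕ.+ m)) (suc (r ℕ.+ j)) * falling (+ (r ℕ.+ j)) r
    ≡⟨ *-congʳ (falling (+ (r ℕ.+ j)) r) (absorb (r ℕ.+ m) (r ℕ.+ j)) ⟩
  + suc (r ℕ.+ m) * binom (r ℕ.+ m) (r ℕ.+ j) * falling (+ (r ℕ.+ j)) r
    ≡⟨ *-assoc (+ suc (r ℕ.+ m)) (binom (r ℕ.+ m) (r ℕ.+ j)) (falling (+ (r ℕ.+ j)) r) ⟩
  + suc (r ℕ.+ m) * (binom (r ℕ.+ m) (r ℕ.+ j) * falling (+ (r ℕ.+ j)) r)
    ≡⟨ *-congˡ (+ suc (r ℕ.+ m)) (binom-falling r m j) ⟩
  + suc (r ℕ.+ m) * (falling (+ (r ℕ.+ m)) r * binom m j)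
    ≡⟨ sym (*-assoc (+ suc (r ℕ.+ m)) (falling (+ (r ℕ.+ m)) r) (binom m j)) ⟩
  + suc (r ℕ.+ m) * falling (+ (r ℕ.+ m)) r * binom m j ∎
  where
  lemma : ∀ x y z → x * (y * z) ≡ y * x * z
  lemma = solve-∀

-- `absorb-top` iterated r times: the upper index is lowered while `k` stays fixed.
falling-binom : ∀ r n k → falling (+ (r ℕ.+ n)) r * binom n k ≡ binom (r ℕ.+ n) k * falling (+ (r ℕ.+ n) - + k) r
falling-binom zero    n k = *-comm 1ℤ (binom n k)
falling-binom (suc r) n k = begin
  + suc x * falling (+ x) r * binom n k
    ≡⟨ *-assoc (+ suc x) (falling (+ x) r) (binom n k) ⟩
  + suc x * (falling (+ x) r * binom n k)
    ≡⟨ *-congˡ (+ suc x) (falling-binom r n k) ⟩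
  + suc x * (binom x k * falling (+ x - + k) r)
    ≡⟨ sym (*-assoc (+ suc x) (binom x k) (falling (+ x - + k) r)) ⟩
  + suc x * binom x k * falling (+ x - + k) r
    ≡⟨ cong₂ (λ u v → u * falling v r) (absorb-top x k) (lemma (+ x) (+ k)) ⟩
  binom (suc x) k * (+ suc x - + k) * falling (+ suc x - + k - 1ℤ) r
    ≡⟨ *-assoc (binom (suc x) k) (+ suc x - + k) (falling (+ suc x - + k - 1ℤ) r) ⟩
  binom (suc x) k * falling (+ suc x - + k) (suc r) ∎
  where
  x : ℕ
  x = r ℕ.+ n
  lemma : ∀ x k → x - k ≡ 1ℤ + x - k - 1ℤ
  lemma = solve-∀

falling-zero : ∀ {k r} → k < r → falling (+ k) r ≡ 0ℤ
falling-zero {zero}  {suc r} (s≤s z≤n) = *-zeroˡ (falling (0ℤ - 1ℤ) r)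
falling-zero {suc k} {suc r} (s≤s k<r) = trans (*-congˡ (+ suc k) (falling-zero k<r)) (*-zeroʳ (+ suc k))

*-cancelʳ-0 : ∀ x {y} → y ≢ 0ℤ → x * y ≡ 0ℤ → x ≡ 0ℤ
*-cancelʳ-0 x y≢0 xy≡0 with i*j≡0⇒i≡0∨j≡0 x xy≡0
... | inj₁ x≡0 = x≡0
... | inj₂ y≡0 = contradiction y≡0 y≢0

falling-nonzero : ∀ {n r} → r ≤ n → falling (+ n) r ≢ 0ℤ
falling-nonzero         z≤n       ()
falling-nonzero {suc n} {suc r} (s≤s r≤n) eq with () ← *-cancelʳ-0 (+ suc n) (falling-nonzero r≤n) eq

-- Vandermonde's convolution and the claimed moments

∑-binom : ℕ → (ℕ → ℤ) → ℤ
∑-binom m g = ∑ (downFrom (suc m)) (λ j → binom m j * g j)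

-- `∑-binom m g` is the m-th power of the operator 1 + shift applied to `g` and evaluated at 0;
-- Pascal's rule splits off one factor.
∑-binom-suc : ∀ m g → ∑-binom (suc m) g ≡ ∑-binom m g + ∑-binom m (g ∘ suc)
∑-binom-suc m g = begin
  ∑-binom (suc m) g
    ≡⟨ ∑-downFrom-suc (suc m) (λ j → binom (suc m) j * g j) ⟩
  1ℤ * g 0 + ∑ (downFrom (suc m)) (λ j → binom (suc m) (suc j) * g (suc j))
    ≡⟨ +-congˡ (1ℤ * g 0) (trans
         (∑-cong (downFrom (suc m)) λ j → trans (*-congʳ (g (suc j)) (pascal m j)) (*-distribʳ-+ (g (suc j)) (binom m j) (binom m (suc j))))
         (∑-+ (downFrom (suc m)) (λ j → binom m j * g (suc j)) (λ j → binom m (suc j) * g (suc j)))) ⟩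
  1ℤ * g 0 + (∑-binom m (g ∘ suc) + ∑ (downFrom (suc m)) (λ j → binom m (suc j) * g (suc j)))
    ≡⟨ lemma (1ℤ * g 0) (∑-binom m (g ∘ suc)) (∑ (downFrom (suc m)) (λ j → binom m (suc j) * g (suc j))) ⟩
  1ℤ * g 0 + ∑ (downFrom (suc m)) (λ j → binom m (suc j) * g (suc j)) + ∑-binom m (g ∘ suc)
    ≡⟨ cong (λ z → z + ∑-binom m (g ∘ suc)) (sym (∑-downFrom-suc (suc m) (λ j → binom m j * g j))) ⟩
  binom m (suc m) * g (suc m) + ∑-binom m g + ∑-binom m (g ∘ suc)
    ≡⟨ cong (λ z → z * g (suc m) + ∑-binom m g + ∑-binom m (g ∘ suc)) (binom-zero (ℕ.n<1+n m)) ⟩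
  0ℤ * g (suc m) + ∑-binom m g + ∑-binom m (g ∘ suc)
    ≡⟨ lemma′ (g (suc m)) (∑-binom m g) (∑-binom m (g ∘ suc)) ⟩
  ∑-binom m g + ∑-binom m (g ∘ suc) ∎
  where
  lemma : ∀ x y z → x + (y + z) ≡ x + z + y
  lemma = solve-∀
  lemma′ : ∀ x y z → 0ℤ * x + y + z ≡ y + z
  lemma′ = solve-∀

-- The usual C(m,m-j) is reflected to C(m,j). The offset `p` stays general because the shift in
-- `∑-binom-suc` raises it.
vandermonde : ∀ m n p → ∑-binom m (λ j → binom n (p ℕ.+ j)) ≡ binom (m ℕ.+ n) (m ℕ.+ p)
vandermonde zero    n p = trans (lemma (binom n (p ℕ.+ 0))) (cong (binom n) (ℕ.+-identityʳ p))
  where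
  lemma : ∀ x → 1ℤ * x + 0ℤ ≡ x
  lemma = solve-∀
vandermonde (suc m) n p = begin
  ∑-binom (suc m) (λ j → binom n (p ℕ.+ j))
    ≡⟨ ∑-binom-suc m (λ j → binom n (p ℕ.+ j)) ⟩
  ∑-binom m (λ j → binom n (p ℕ.+ j)) + ∑-binom m (λ j → binom n (p ℕ.+ suc j))
    ≡⟨ cong₂ _+_ (vandermonde m n p)
         (trans (∑-cong (downFrom (suc m)) λ j → cong (λ i → binom m j * binom n i) (ℕ.+-suc p j)) (vandermonde m n (suc p))) ⟩
  binom (m ℕ.+ n) (m ℕ.+ p) + binom (m ℕ.+ n) (m ℕ.+ suc p)
    ≡⟨ cong (λ i → binom (m ℕ.+ n) (m ℕ.+ p) + binom (m ℕ.+ n) i) (ℕ.+-suc m p) ⟩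
  binom (m ℕ.+ n) (m ℕ.+ p) + binom (m ℕ.+ n) (suc (m ℕ.+ p))
    ≡⟨ sym (pascal (m ℕ.+ n) (m ℕ.+ p)) ⟩
  binom (suc m ℕ.+ n) (suc m ℕ.+ p) ∎

∑-downFrom-drop : ∀ r n (f : ℕ → ℤ) → (∀ k → k < r → f k ≡ 0ℤ) →
  ∑ (downFrom (r ℕ.+ n)) f ≡ ∑ (downFrom n) (λ j → f (r ℕ.+ j))
∑-downFrom-drop zero    n f f≡0 = refl
∑-downFrom-drop (suc r) n f f≡0 = begin
  ∑ (downFrom (suc r ℕ.+ n)) f                       ≡⟨ ∑-downFrom-suc (r ℕ.+ n) f ⟩
  f 0 + ∑ (downFrom (r ℕ.+ n)) (f ∘ suc)             ≡⟨ cong₂ _+_ (f≡0 0 (s≤s z≤n)) (∑-downFrom-drop r n (f ∘ suc) λ k k<r → f≡0 (suc k) (s≤s k<r)) ⟩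
  0ℤ + ∑ (downFrom n) (λ j → f (suc r ℕ.+ j))        ≡⟨ +-identityˡ (∑ (downFrom n) (λ j → f (suc r ℕ.+ j))) ⟩
  ∑ (downFrom n) (λ j → f (suc r ℕ.+ j))             ∎

-- The r-th moment of the claimed distribution without its constant factor (s+t)/(st C(s+t,s)).
formula-moment : ℕ → ℕ → ℕ → ℤ
formula-moment s t r = ∑ (downFrom (suc s)) (λ k → + k * binom s k * binom t k * falling (+ k) r)

-- At order 0 the sum includes k = 0, where `absorb` does not apply; that term is zero and is split
-- off before k is absorbed into C(s+1,k).
formula-moment-0 : ∀ s t → formula-moment (suc s) t 0 ≡ + suc s * binom (s ℕ.+ t) (suc s)
formula-moment-0 s t = begin
  formula-moment (suc s) t 0
    ≡⟨ ∑-downFrom-suc (suc s) (λ k → + k * binom (suc s) k * binom t k * 1ℤ) ⟩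
  0ℤ + ∑ (downFrom (suc s)) (λ k → + suc k * binom (suc s) (suc k) * binom t (suc k) * 1ℤ)
    ≡⟨ +-identityˡ (∑ (downFrom (suc s)) (λ k → + suc k * binom (suc s) (suc k) * binom t (suc k) * 1ℤ)) ⟩
  ∑ (downFrom (suc s)) (λ k → + suc k * binom (suc s) (suc k) * binom t (suc k) * 1ℤ)
    ≡⟨ ∑-cong (downFrom (suc s)) (λ k → trans (cong (λ z → z * binom t (suc k) * 1ℤ) (absorb s k))
         (lemma (+ suc s) (binom s k) (binom t (suc k)))) ⟩
  ∑ (downFrom (suc s)) (λ k → + suc s * (binom s k * binom t (suc k)))
    ≡⟨ ∑-*ˡ (downFrom (suc s)) (+ suc s) (λ k → binom s k * binom t (suc k)) ⟩
  + suc s * ∑-binom s (λ k → binom t (suc k))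
    ≡⟨ *-congˡ (+ suc s) (trans (vandermonde s t 1) (cong (binom (s ℕ.+ t)) (ℕ.+-comm s 1))) ⟩
  + suc s * binom (s ℕ.+ t) (suc s) ∎
  where
  lemma : ∀ x y z → x * y * z * 1ℤ ≡ x * (y * z)
  lemma = solve-∀

-- Terms with k < r vanish. In the others k is absorbed into C(t+1,k) and k^(r) into C(s,k), which
-- leaves a Vandermonde sum.
formula-moment-suc : ∀ q m t → formula-moment (suc q ℕ.+ m) (suc t) (suc q)
  ≡ + suc t * falling (+ (suc q ℕ.+ m)) (suc q) * binom (m ℕ.+ t) (m ℕ.+ q)
formula-moment-suc q m t = begin
  formula-moment s (suc t) r
    ≡⟨ cong (λ n → ∑ (downFrom n) f) (sym (ℕ.+-suc r m)) ⟩
  ∑ (downFrom (r ℕ.+ suc m)) f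
    ≡⟨ ∑-downFrom-drop r (suc m) f (λ k k<r → trans (*-congˡ (+ k * binom s k * binom (suc t) k) (falling-zero k<r)) (*-zeroʳ (+ k * binom s k * binom (suc t) k))) ⟩
  ∑ (downFrom (suc m)) (λ j → f (r ℕ.+ j))
    ≡⟨ ∑-cong (downFrom (suc m)) (λ j → term j) ⟩
  ∑ (downFrom (suc m)) (λ j → + suc t * falling (+ s) r * (binom m j * binom t (q ℕ.+ j)))
    ≡⟨ ∑-*ˡ (downFrom (suc m)) (+ suc t * falling (+ s) r) (λ j → binom m j * binom t (q ℕ.+ j)) ⟩
  + suc t * falling (+ s) r * ∑-binom m (λ j → binom t (q ℕ.+ j))
    ≡⟨ *-congˡ (+ suc t * falling (+ s) r) (vandermonde m t q) ⟩
  + suc t * falling (+ s) r * binom (m ℕ.+ t) (m ℕ.+ q) ∎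
  where
  r s : ℕ
  r = suc q
  s = r ℕ.+ m
  f : ℕ → ℤ
  f k = + k * binom s k * binom (suc t) k * falling (+ k) r
  lemma₁ : ∀ k x y z → k * x * y * z ≡ (k * y) * (x * z)
  lemma₁ = solve-∀
  lemma₂ : ∀ t y x z → (t * y) * (x * z) ≡ t * x * (z * y)
  lemma₂ = solve-∀
  term : ∀ j → f (r ℕ.+ j) ≡ + suc t * falling (+ s) r * (binom m j * binom t (q ℕ.+ j))
  term j = begin
    + k * binom s k * binom (suc t) k * falling (+ k) r
      ≡⟨ lemma₁ (+ k) (binom s k) (binom (suc t) k) (falling (+ k) r) ⟩
    (+ k * binom (suc t) k) * (binom s k * falling (+ k) r)
      ≡⟨ cong₂ _*_ (absorb t (q ℕ.+ j)) (binom-falling r m j) ⟩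
    (+ suc t * binom t (q ℕ.+ j)) * (falling (+ s) r * binom m j)
      ≡⟨ lemma₂ (+ suc t) (binom t (q ℕ.+ j)) (falling (+ s) r) (binom m j) ⟩
    + suc t * falling (+ s) r * (binom m j * binom t (q ℕ.+ j)) ∎
    where
    k : ℕ
    k = r ℕ.+ j

-- The parts have sizes `suc s` and `suc t`, so `s + suc t` is `N`. For positive r the bound
-- supplies m with `suc s = r + m`.
formula-moment-closed : ∀ s t r → r ≤ suc s →
  formula-moment (suc s) (suc t) r * falling (+ (s ℕ.+ suc t)) r * + (suc s ℕ.+ suc t)
    ≡ + suc s * + suc t * binom (suc s ℕ.+ suc t) (suc s) * (falling (+ suc s) r * falling (+ suc t) r)
formula-moment-closed s t zero    _ = begin
  formula-moment (suc s) (suc t) 0 * 1ℤ * + (suc s ℕ.+ suc t)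
    ≡⟨ cong (λ z → z * 1ℤ * + (suc s ℕ.+ suc t)) (formula-moment-0 s (suc t)) ⟩
  + suc s * binom (s ℕ.+ suc t) (suc s) * 1ℤ * + suc (s ℕ.+ suc t)
    ≡⟨ lemma₁ (+ suc s) (binom (s ℕ.+ suc t) (suc s)) (+ suc (s ℕ.+ suc t)) ⟩
  + suc s * (+ suc (s ℕ.+ suc t) * binom (s ℕ.+ suc t) (suc s))
    ≡⟨ *-congˡ (+ suc s) (absorb-top (s ℕ.+ suc t) (suc s)) ⟩
  + suc s * (binom (suc s ℕ.+ suc t) (suc s) * (+ suc s + + suc t - + suc s))
    ≡⟨ lemma₂ (+ suc s) (+ suc t) (binom (suc s ℕ.+ suc t) (suc s)) ⟩
  + suc s * + suc t * binom (suc s ℕ.+ suc t) (suc s) * 1ℤ ∎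
  where
  lemma₁ : ∀ s b n → s * b * 1ℤ * n ≡ s * (n * b)
  lemma₁ = solve-∀
  lemma₂ : ∀ s t b → s * (b * (s + t - s)) ≡ s * t * b * 1ℤ
  lemma₂ = solve-∀
formula-moment-closed s t (suc q) (s≤s q≤s) with s | ℕ.m≤n⇒∃[o]m+o≡n q≤s
... | _ | m , refl = begin
  formula-moment (suc q ℕ.+ m) (suc t) (suc q) * falling (+ y) (suc q) * + suc y
    ≡⟨ cong (λ z → z * falling (+ y) (suc q) * + suc y) (formula-moment-suc q m t) ⟩
  + suc t * x * binom (m ℕ.+ t) (m ℕ.+ q) * falling (+ y) (suc q) * + suc y
    ≡⟨ lemma₁ (+ suc t) x (binom (m ℕ.+ t) (m ℕ.+ q)) (falling (+ y) (suc q)) (+ suc y) ⟩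
  + suc t * x * (+ suc y * (falling (+ y) (suc q) * binom (m ℕ.+ t) (m ℕ.+ q)))
    ≡⟨ cong (λ z → + suc t * x * (+ suc y * z)) top ⟩
  + suc t * x * (+ suc y * (binom y (q ℕ.+ m) * falling (+ suc t) (suc q)))
    ≡⟨ cong (λ z → + suc t * x * z) (trans
         (sym (*-assoc (+ suc y) (binom y (q ℕ.+ m)) (falling (+ suc t) (suc q))))
         (*-congʳ (falling (+ suc t) (suc q)) (sym (absorb y (q ℕ.+ m))))) ⟩
  + suc t * x * (+ suc (q ℕ.+ m) * binom (suc y) (suc (q ℕ.+ m)) * falling (+ suc t) (suc q))
    ≡⟨ lemma₂ (+ suc t) x (+ suc (q ℕ.+ m)) (binom (suc y) (suc (q ℕ.+ m))) (falling (+ suc t) (suc q)) ⟩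
  + suc (q ℕ.+ m) * + suc t * binom (suc y) (suc (q ℕ.+ m)) * (x * falling (+ suc t) (suc q)) ∎
  where
  y : ℕ
  y = q ℕ.+ m ℕ.+ suc t
  x : ℤ
  x = falling (+ (suc q ℕ.+ m)) (suc q)
  lemma₁ : ∀ t x b f y → t * x * b * f * y ≡ t * x * (y * (f * b))
  lemma₁ = solve-∀
  lemma₂ : ∀ t x s b f → t * x * (s * b * f) ≡ s * t * b * (x * f)
  lemma₂ = solve-∀
  y≡ : y ≡ suc q ℕ.+ (m ℕ.+ t)
  y≡ = trans (ℕ.+-assoc q m (suc t)) (trans (cong (q ℕ.+_) (ℕ.+-suc m t)) (ℕ.+-suc q (m ℕ.+ t)))
  lemma₃ : ∀ x z → x + z - x ≡ z
  lemma₃ = solve-∀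
  -- Since y - (q + m) = t + 1, lowering the upper index r times trades y^(r) for (t+1)^(r).
  top : falling (+ y) (suc q) * binom (m ℕ.+ t) (m ℕ.+ q) ≡ binom y (q ℕ.+ m) * falling (+ suc t) (suc q)
  top = begin
    falling (+ y) (suc q) * binom (m ℕ.+ t) (m ℕ.+ q)
      ≡⟨ cong₂ (λ i j → falling (+ i) (suc q) * binom (m ℕ.+ t) j) y≡ (ℕ.+-comm m q) ⟩
    falling (+ (suc q ℕ.+ (m ℕ.+ t))) (suc q) * binom (m ℕ.+ t) (q ℕ.+ m)
      ≡⟨ falling-binom (suc q) (m ℕ.+ t) (q ℕ.+ m) ⟩
    binom (suc q ℕ.+ (m ℕ.+ t)) (q ℕ.+ m) * falling (+ (suc q ℕ.+ (m ℕ.+ t)) - + (q ℕ.+ m)) (suc q)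
      ≡⟨ cong (λ i → binom i (q ℕ.+ m) * falling (+ i - + (q ℕ.+ m)) (suc q)) (sym y≡) ⟩
    binom y (q ℕ.+ m) * falling (+ (q ℕ.+ m) + + suc t - + (q ℕ.+ m)) (suc q)
      ≡⟨ cong (λ z → binom y (q ℕ.+ m) * falling z (suc q)) (lemma₃ (+ (q ℕ.+ m)) (+ suc t)) ⟩
    binom y (q ℕ.+ m) * falling (+ suc t) (suc q) ∎

-- Moments determine a distribution of bounded support

-- The system is triangular: k^(n) vanishes for k < n, so only the term at n survives in the moment
-- of order n.
moments-determine-last : ∀ n (d : ℕ → ℤ) → ∑ (downFrom (suc n)) (λ k → d k * falling (+ k) n) ≡ 0ℤ → d n ≡ 0ℤ
moments-determine-last n d moment≡0 = *-cancelʳ-0 (d n) (falling-nonzero {n} ℕ.≤-refl) (begin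
  d n * falling (+ n) n
    ≡⟨ sym (+-identityʳ (d n * falling (+ n) n)) ⟩
  d n * falling (+ n) n + 0ℤ
    ≡⟨ +-congˡ (d n * falling (+ n) n) (sym (trans
         (∑-cong-∈ (downFrom n) λ k k∈ → trans (*-congˡ (d k) (falling-zero (∈-downFrom⁻ k∈))) (*-zeroʳ (d k)))
         (∑-0 (downFrom n) λ _ → refl))) ⟩
  d n * falling (+ n) n + ∑ (downFrom n) (λ k → d k * falling (+ k) n)
    ≡⟨ moment≡0 ⟩
  0ℤ ∎)

-- Back substitution: the highest order settles the top value, and what remains is the same system
-- with one value fewer.
moments-determine : ∀ n (d : ℕ → ℤ) →
  (∀ r → r < n → ∑ (downFrom n) (λ k → d k * falling (+ k) r) ≡ 0ℤ) → ∀ k → k < n → d k ≡ 0ℤ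
moments-determine (suc n) d moments k (s≤s k≤n) with ℕ.m≤n⇒m<n∨m≡n k≤n
... | inj₂ refl = moments-determine-last n d (moments n ℕ.≤-refl)
... | inj₁ k<n  = moments-determine n d (λ r r<n → begin
    ∑ (downFrom n) (λ k → d k * falling (+ k) r)
      ≡⟨ lemma (falling (+ n) r) (∑ (downFrom n) (λ k → d k * falling (+ k) r)) ⟩
    0ℤ * falling (+ n) r + ∑ (downFrom n) (λ k → d k * falling (+ k) r)
      ≡⟨ cong (λ z → z * falling (+ n) r + ∑ (downFrom n) (λ k → d k * falling (+ k) r)) (sym (moments-determine-last n d (moments n ℕ.≤-refl))) ⟩
    d n * falling (+ n) r + ∑ (downFrom n) (λ k → d k * falling (+ k) r)
      ≡⟨ moments r (ℕ.m≤n⇒m≤1+n r<n) ⟩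
    0ℤ ∎) k k<n
  where
  lemma : ∀ x y → y ≡ 0ℤ * x + y
  lemma = solve-∀

-- Comparison of the two distributions

/-cong-cross : ∀ a b d e .{{_ : NonZero d}} .{{_ : NonZero e}} → a * + e ≡ b * + d → a / d ≡ b / e
/-cong-cross a b (suc d) (suc e) eq = fromℚᵘ-cong {mkℚᵘ a d} {mkℚᵘ b e} (*≡* eq)

∑-downFrom-δ : ∀ n i (g : ℕ → ℤ) → i < n → ∑ (downFrom n) (λ k → ⟦ does (i ℕ.≟ k) ⟧ * g k) ≡ g i
∑-downFrom-δ (suc n) i g (s≤s i≤n) with ℕ.m≤n⇒m<n∨m≡n i≤n
... | inj₁ i<n = begin
  ⟦ does (i ℕ.≟ n) ⟧ * g n + ∑ (downFrom n) (λ k → ⟦ does (i ℕ.≟ k) ⟧ * g k)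
    ≡⟨ cong₂ (λ b z → ⟦ b ⟧ * g n + z) (dec-false (i ℕ.≟ n) (ℕ.<⇒≢ i<n)) (∑-downFrom-δ n i g i<n) ⟩
  0ℤ * g n + g i
    ≡⟨ lemma (g n) (g i) ⟩
  g i ∎
  where
  lemma : ∀ x y → 0ℤ * x + y ≡ y
  lemma = solve-∀
... | inj₂ refl = begin
  ⟦ does (i ℕ.≟ i) ⟧ * g i + ∑ (downFrom i) (λ k → ⟦ does (i ℕ.≟ k) ⟧ * g k)
    ≡⟨ cong₂ (λ b z → ⟦ b ⟧ * g i + z) (dec-true (i ℕ.≟ i) refl) (trans
         (∑-cong-∈ (downFrom i) (λ k k∈ → trans
           (cong (λ b → ⟦ b ⟧ * g k) (dec-false (i ℕ.≟ k) (ℕ.>⇒≢ (∈-downFrom⁻ k∈)))) (*-zeroˡ (g k))))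
         (∑-0 (downFrom i) λ _ → refl)) ⟩
  1ℤ * g i + 0ℤ
    ≡⟨ lemma (g i) ⟩
  g i ∎
  where
  lemma : ∀ x → 1ℤ * x + 0ℤ ≡ x
  lemma = solve-∀

module _ (s′ t′ : ℕ) where
  private
    s t : ℕ
    s = suc s′
    t = suc t′

  open Bipartite s t

  count : ℕ → ℤ
  count k = ∑ (orderings Ks,t) (λ σ → ⟦ does (starts (λ _ → false) σ ℕ.≟ k) ⟧)

  countOrderings-count : ∀ k → + countOrderings (K s t) k ≡ count k
  countOrderings-count k = trans
    (length-filter-∑ (λ σ → components (s ℕ.+ t) (forestOf (K s t) σ) ℕ.≟ k) (orderings Ks,t))
    (∑-cong-∈ (orderings Ks,t) λ σ σ∈ → cong (λ x → ⟦ does (x ℕ.≟ k) ⟧) (components-ordering s t σ∈))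

  count-zero : ∀ {k} → s < k → count k ≡ 0ℤ
  count-zero {k} s<k = trans
    (∑-cong-∈ (orderings Ks,t) λ σ σ∈ → cong ⟦_⟧ (dec-false (starts (λ _ → false) σ ℕ.≟ k) (ℕ.<⇒≢ (ℕ.≤-<-trans (starts≤s s t σ∈) s<k))))
    (∑-0 (orderings Ks,t) λ _ → refl)

  count-moment : ∀ r → ∑ (downFrom (suc s)) (λ k → count k * falling (+ k) r) ≡ moment Ks,t (λ _ → false) r
  count-moment r = begin
    ∑ (downFrom (suc s)) (λ k → count k * falling (+ k) r)
      ≡⟨ ∑-cong (downFrom (suc s)) (λ k → sym (∑-*ʳ (orderings Ks,t) (λ σ → ⟦ does (starts (λ _ → false) σ ℕ.≟ k) ⟧) (falling (+ k) r))) ⟩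
    ∑ (downFrom (suc s)) (λ k → ∑ (orderings Ks,t) (λ σ → ⟦ does (starts (λ _ → false) σ ℕ.≟ k) ⟧ * falling (+ k) r))
      ≡⟨ ∑-swap (downFrom (suc s)) (orderings Ks,t) (λ k σ → ⟦ does (starts (λ _ → false) σ ℕ.≟ k) ⟧ * falling (+ k) r) ⟩
    ∑ (orderings Ks,t) (λ σ → ∑ (downFrom (suc s)) (λ k → ⟦ does (starts (λ _ → false) σ ℕ.≟ k) ⟧ * falling (+ k) r))
      ≡⟨ ∑-cong-∈ (orderings Ks,t) (λ σ σ∈ → ∑-downFrom-δ (suc s) (starts (λ _ → false) σ) (λ k → falling (+ k) r) (s≤s (starts≤s s t σ∈))) ⟩
    moment Ks,t (λ _ → false) r ∎

  private
    D L : ℤ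
    D = + s * + t * binom (s ℕ.+ t) s
    L = + (length Ks,t !)

    φ : ℕ → ℤ
    φ k = + k * binom s k * binom t k

  -- The moments reach only the values up to s; for larger k both sides are zero, by `starts≤s` and
  -- by C(s,k) = 0.
  count-closed : ∀ k → D * count k ≡ L * (+ (s ℕ.+ t) * φ k)
  count-closed k with k ℕ.≤? s
  ... | no k≰s = begin
    D * count k                              ≡⟨ *-congˡ D (count-zero (ℕ.≰⇒> k≰s)) ⟩
    D * 0ℤ                                   ≡⟨ lemma D L (+ (s ℕ.+ t)) (+ k) (binom t k) ⟩
    L * (+ (s ℕ.+ t) * (+ k * 0ℤ * binom t k)) ≡⟨ cong (λ z → L * (+ (s ℕ.+ t) * (+ k * z * binom t k))) (sym (binom-zero (ℕ.≰⇒> k≰s))) ⟩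
    L * (+ (s ℕ.+ t) * φ k)                  ∎
    where
    lemma : ∀ d l n k x → d * 0ℤ ≡ l * (n * (k * 0ℤ * x))
    lemma = solve-∀
  ... | yes k≤s = i-j≡0⇒i≡j (D * count k) (L * (+ (s ℕ.+ t) * φ k))
    (moments-determine (suc s) (λ k → D * count k - L * (+ (s ℕ.+ t) * φ k)) vanish k (s≤s k≤s))
    where
    vanish : ∀ r → r < suc s →
      ∑ (downFrom (suc s)) (λ k → (D * count k - L * (+ (s ℕ.+ t) * φ k)) * falling (+ k) r) ≡ 0ℤ
    -- The cancelled factor is `ν`: here `s′ + t` is s + t - 1, which is at least s because t ≥ 1,
    -- so `ν` is nonzero for r ≤ s.
    vanish r (s≤s r≤s) = *-cancelʳ-0 _ (falling-nonzero {s′ ℕ.+ t} (ℕ.≤-trans r≤s (ℕ.≤-trans (ℕ.m≤m+n s t′) (ℕ.≤-reflexive (sym (ℕ.+-suc s′ t′)))))) (begin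
      ∑ (downFrom (suc s)) (λ k → (D * count k - L * (+ (s ℕ.+ t) * φ k)) * falling (+ k) r) * ν
        ≡⟨ *-congʳ ν (begin
          ∑ (downFrom (suc s)) (λ k → (D * count k - L * (+ (s ℕ.+ t) * φ k)) * falling (+ k) r)
            ≡⟨ ∑-cong (downFrom (suc s)) (λ k → lemma₁ D (count k) L (+ (s ℕ.+ t)) (φ k) (falling (+ k) r)) ⟩
          ∑ (downFrom (suc s)) (λ k → D * (count k * falling (+ k) r) - L * + (s ℕ.+ t) * (φ k * falling (+ k) r))
            ≡⟨ ∑-minus (downFrom (suc s)) (λ k → D * (count k * falling (+ k) r)) (λ k → L * + (s ℕ.+ t) * (φ k * falling (+ k) r)) ⟩
          ∑ (downFrom (suc s)) (λ k → D * (count k * falling (+ k) r)) - ∑ (downFrom (suc s)) (λ k → L * + (s ℕ.+ t) * (φ k * falling (+ k) r))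
            ≡⟨ cong₂ _-_ (trans (∑-*ˡ (downFrom (suc s)) D (λ k → count k * falling (+ k) r)) (*-congˡ D (count-moment r)))
                 (∑-*ˡ (downFrom (suc s)) (L * + (s ℕ.+ t)) (λ k → φ k * falling (+ k) r)) ⟩
          D * moment Ks,t (λ _ → false) r - L * + (s ℕ.+ t) * formula-moment s t r ∎) ⟩
      (D * moment Ks,t (λ _ → false) r - L * + (s ℕ.+ t) * formula-moment s t r) * ν
        ≡⟨ lemma₂ D (moment Ks,t (λ _ → false) r) L (+ (s ℕ.+ t)) (formula-moment s t r) ν ⟩
      D * (moment Ks,t (λ _ → false) r * ν) - L * (formula-moment s t r * ν * + (s ℕ.+ t))
        -- For these successor sizes `N` computes to `+ (s′ ℕ.+ t)`, so `moment-K` speaks of `ν` as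
        -- it stands.
        ≡⟨ cong₂ (λ x y → D * x - L * y) (moment-K r) (formula-moment-closed s′ t′ r r≤s) ⟩
      D * (L * (falling (+ s) r * falling (+ t) r)) - L * (D * (falling (+ s) r * falling (+ t) r))
        ≡⟨ lemma₃ D L (falling (+ s) r * falling (+ t) r) ⟩
      0ℤ ∎)
      where
      ν : ℤ
      ν = falling (+ (s′ ℕ.+ t)) r
      lemma₁ : ∀ d c l m p f → (d * c - l * (m * p)) * f ≡ d * (c * f) - l * m * (p * f)
      lemma₁ = solve-∀
      lemma₂ : ∀ d g l m p n → (d * g - l * m * p) * n ≡ d * (g * n) - l * (p * n * m)
      lemma₂ = solve-∀
      lemma₃ : ∀ d l x → d * (l * x) - l * (d * x) ≡ 0ℤ
      lemma₃ = solve-∀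

  denom-pos : + denom s t ≡ D
  denom-pos = trans (pos-* (s ℕ.* t) ((s ℕ.+ t) C s)) (*-congʳ (binom (s ℕ.+ t) s) (pos-* s t))

  numerator-pos : ∀ k → + (k ℕ.* (s ℕ.+ t) ℕ.* (s C k) ℕ.* (t C k)) ≡ + (s ℕ.+ t) * φ k
  numerator-pos k = begin
    + (k ℕ.* (s ℕ.+ t) ℕ.* (s C k) ℕ.* (t C k))
      ≡⟨ pos-* (k ℕ.* (s ℕ.+ t) ℕ.* (s C k)) (t C k) ⟩
    + (k ℕ.* (s ℕ.+ t) ℕ.* (s C k)) * binom t k
      ≡⟨ *-congʳ (binom t k) (pos-* (k ℕ.* (s ℕ.+ t)) (s C k)) ⟩
    + (k ℕ.* (s ℕ.+ t)) * binom s k * binom t k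
      ≡⟨ cong (λ z → z * binom s k * binom t k) (pos-* k (s ℕ.+ t)) ⟩
    + k * + (s ℕ.+ t) * binom s k * binom t k
      ≡⟨ lemma (+ k) (+ (s ℕ.+ t)) (binom s k) (binom t k) ⟩
    + (s ℕ.+ t) * φ k ∎
    where
    lemma : ∀ k n x y → k * n * x * y ≡ n * (k * x * y)
    lemma = solve-∀

  cross : ∀ k → + countOrderings (K s t) k * + denom s t
    ≡ + (k ℕ.* (s ℕ.+ t) ℕ.* (s C k) ℕ.* (t C k)) * L
  cross k = begin
    + countOrderings (K s t) k * + denom s t ≡⟨ cong₂ _*_ (countOrderings-count k) denom-pos ⟩
    count k * D                              ≡⟨ *-comm (count k) D ⟩
    D * count k                              ≡⟨ count-closed k ⟩
    L * (+ (s ℕ.+ t) * φ k)                  ≡⟨ *-comm L (+ (s ℕ.+ t) * φ k) ⟩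
    + (s ℕ.+ t) * φ k * L                    ≡⟨ *-congʳ L (sym (numerator-pos k)) ⟩
    + (k ℕ.* (s ℕ.+ t) ℕ.* (s C k) ℕ.* (t C k)) * L ∎

theorem2 : (s t : ℕ) → .{{_ : NonZero s}} → .{{_ : NonZero t}} →
    (k : ℕ) → P (K s t) k ≡ formula s t k
theorem2 s@(suc s′) t@(suc t′) k = /-cong-cross
  (+ countOrderings (K s t) k) (+ (k ℕ.* (s ℕ.+ t) ℕ.* (s C k) ℕ.* (t C k)))
  (length (edges (K s t)) !) (denom s t)
  {{length (edges (K s t)) ℕ.!≢0}} {{denom-nonZero s t}} (cross s′ t′ k)
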